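{- Let $\mathbb{F}$ be any field, $k\le n$ positive integers, and let $\le$ be the neglex term order on $\mathbb{F}[x_1,\dots,x_n]$. Then the standard monomial basis of $S_{n,k} = \mathbb{F}[x_1,\dots,x_n]/J_{n,k}$ with respect to $\le$ is $\mathcal{C}_{n,k}$, the set of $(n,k)$-reverse nonskip monomials.
   Context: $J_{n,k} = \langle h_k(x_1), h_k(x_1,x_2), \dots, h_k(x_1,\dots,x_n), e_n(x_1,\dots,x_n), \dots, e_{n-k+1}(x_1,\dots,x_n)\rangle$, where $h_d(x_1,\dots,x_i)=\sum_{1\le j_1\le\cdots\le j_d\le i}x_{j_1}\cdots x_{j_d}$ and $e_d$ is the elementary symmetric polynomial. The neglex term order is the lexicographic order with respect to $x_n > x_{n-1} > \cdots > x_1$: $x_1^{a_1}\cdots x_n^{a_n} < x_1^{b_1}\cdots x_n^{b_n}$ iff there is $j$ with $a_{j+1}=b_{j+1},\dots,a_n=b_n$ and $a_j<b_j$. The standard monomial basis of $\mathbb{F}[x_1,\dots,x_n]/I$ is the set of monomials not in the initial ideal $\mathrm{in}_<(I)=\langle \mathrm{in}_<(f): f\in I\setminus\{0\}\rangle$. For $S=\{s_1<\cdots<s_m\}\subseteq[n]$, the reverse skip monomial is $\mathbf{x}(S)^* = x_{n-s_1+1}^{s_1}x_{n-s_2+1}^{s_2-1}\cdots x_{n-s_m+1}^{s_m-m+1}$. A monomial $m$ is $(n,k)$-reverse nonskip if $x_i^k\nmid m$ for all $1\le i\le n$ and $\mathbf{x}(S)^*\nmid m$ for all $S\subseteq[n]$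 with $|S|=n-k+1$. -}

module Defs where

open import Level using (Level; _⊔_)
open import Algebra.Bundles using (CommutativeRing)
open import Data.Nat as ℕ using (ℕ; zero; suc; _≤_; _<_; _∸_)
open import Data.Fin as Fin using (Fin; toℕ; opposite)
open import Data.Fin.Subset using (Subset; ∣_∣)
open import Data.Bool using (Bool; true; false; if_then_else_)
open import Data.Vec as Vec using (Vec; []; _∷_; lookup; tabulate)
open import Data.Vec.Properties using (≡-dec)
open import Data.List as List using (List; []; _∷_; _++_; concatMap; map; upTo; length; zipWith)
open import Data.Product using (Σ; _×_; _,_)
open import Relation.Nullary using (¬_; yes; no)
open import Relation.Binary.PropositionalEquality using (_≡_)

record Field (c ℓ : Level) : Set (Level.suc (c ⊔ ℓ)) where
  field
    commutativeRing : CommutativeRing c ℓ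
  open CommutativeRing commutativeRing public
  field
    0≉1     : ¬ (0# ≈ 1#)
    inverse : ∀ x → ¬ (x ≈ 0#) → Σ Carrier λ y → (x * y) ≈ 1#

-- Monomials in x₁,…,xₙ: exponent vectors; index i : Fin n is x_{toℕ i + 1}.

Monomial : ℕ → Set
Monomial n = Vec ℕ n

_∣ₘ_ : ∀ {n} → Monomial n → Monomial n → Set
_∣ₘ_ {n} a b = ∀ (i : Fin n) → lookup a i ≤ lookup b i

_<nl_ : ∀ {n} → Monomial n → Monomial n → Set
_<nl_ {n} a b = Σ (Fin n) λ j →
  (lookup a j < lookup b j) × (∀ (j' : Fin n) → toℕ j < toℕ j' → lookup a j' ≡ lookup b j')

monsSupp : (n i d : ℕ) → List (Monomial n)
monsSupp zero i zero = [] ∷ []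
monsSupp zero i (suc d) = []
monsSupp (suc n) zero d = map (0 ∷_) (monsSupp n zero d)
monsSupp (suc n) (suc i) d =
  concatMap (λ a → map (a ∷_) (monsSupp n i (d ∸ a))) (upTo (suc d))

monsSqfree : (n d : ℕ) → List (Monomial n)
monsSqfree zero zero = [] ∷ []
monsSqfree zero (suc d) = []
monsSqfree (suc n) zero = map (0 ∷_) (monsSqfree n zero)
monsSqfree (suc n) (suc d) = map (0 ∷_) (monsSqfree n (suc d)) ++ map (1 ∷_) (monsSqfree n d)

countBelow : ∀ {n} → Subset n → Fin n → ℕ
countBelow (b ∷ S) Fin.zero = 0
countBelow (b ∷ S) (Fin.suc i) = (if b then 1 else 0) ℕ.+ countBelow S i

-- Element i : Fin n of S stands for s = toℕ i + 1 ∈ [n].  If s = s_j then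
-- the exponent of x_{n-s+1} (index opposite i) is s_j - j + 1 = s - #{t ∈ S : t < s}.
revSkipExp : ∀ {n} → Subset n → Fin n → ℕ
revSkipExp S i with lookup S i
... | true  = suc (toℕ i) ∸ countBelow S i
... | false = 0

revSkip : ∀ {n} → Subset n → Monomial n
revSkip S = tabulate (λ p → revSkipExp S (opposite p))

ReverseNonskip : (n k : ℕ) → Monomial n → Set
ReverseNonskip n k m =
  (∀ (i : Fin n) → ¬ (k ≤ lookup m i)) ×
  (∀ (S : Subset n) → ∣ S ∣ ≡ n ∸ k ℕ.+ 1 → ¬ (revSkip S ∣ₘ m))

module Poly {c ℓ} (F : Field c ℓ) where
  open Field F

  Pol : ℕ → Set c
  Pol n = List (Carrier × Monomial n)

  coeff : ∀ {n} → Pol n → Monomial n → Carrier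
  coeff [] m = 0#
  coeff ((a , v) ∷ p) m with ≡-dec ℕ._≟_ v m
  ... | yes _ = a + coeff p m
  ... | no  _ = coeff p m

  _≈P_ : ∀ {n} → Pol n → Pol n → Set ℓ
  p ≈P q = ∀ m → coeff p m ≈ coeff q m

  _+P_ : ∀ {n} → Pol n → Pol n → Pol n
  p +P q = p ++ q

  _*P_ : ∀ {n} → Pol n → Pol n → Pol n
  p *P q = concatMap (λ { (a , v) → map (λ { (b , w) → (a * b , Vec.zipWith ℕ._+_ v w) }) q }) p

  sumP : ∀ {n} → List (Pol n) → Pol n
  sumP = List.foldr _+P_ []

  sumMons : ∀ {n} → List (Monomial n) → Pol n
  sumMons = map (1# ,_)

  h : (n d i : ℕ) → Pol n
  h n d i = sumMons (monsSupp n i d)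

  e : (n d : ℕ) → Pol n
  e n d = sumMons (monsSqfree n d)

  Jgens : (n k : ℕ) → List (Pol n)
  Jgens n k = map (λ i → h n k (suc i)) (upTo n)
           ++ map (λ j → e n (n ∸ j)) (upTo k)

  InIdeal : ∀ {n} → List (Pol n) → Pol n → Set (c ⊔ ℓ)
  InIdeal {n} gens f = Σ (List (Pol n)) λ gs →
    (length gs ≡ length gens) × (f ≈P sumP (zipWith _*P_ gs gens))

  IsInitial : ∀ {n} → Pol n → Monomial n → Set ℓ
  IsInitial f m = ¬ (coeff f m ≈ 0#) × (∀ m' → m <nl m' → coeff f m' ≈ 0#)

  -- membership of a monomial in in_<(I) = ⟨ in_<(f) : f ∈ I, f ≠ 0 ⟩
  -- (a monomial lies in a monomial ideal iff some generator divides it)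
  InInitialIdeal : ∀ {n} → List (Pol n) → Monomial n → Set (c ⊔ ℓ)
  InInitialIdeal {n} gens m = Σ (Pol n) λ f → Σ (Monomial n) λ m₀ →
    InIdeal gens f × IsInitial f m₀ × (m₀ ∣ₘ m)

  Standard : (n k : ℕ) → Monomial n → Set (c ⊔ ℓ)
  Standard n k m = ¬ InInitialIdeal (Jgens n k) m

{-# OPTIONS --safe #-}
module Submission where

-- Both inclusions are obtained by pairing polynomials with linear functionals on them.
--
-- Skip monomials are initial.  The initial monomial of h_k(x_1..x_i) is x_i^k.  The ideal
-- generated by the symmetric polynomials e_j, j > n - k, is stable under divided differences,
-- and contains (x_1 ⋯ x_{n-k+1})^k.  When the initial monomial has exponents (a + 1, 0) at
-- (x_i, x_{i+1}), applying the divided difference ∂_i changes them to (0, a); in this way every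
-- x(S)* is reached from (x_1 ⋯ x_{n-k+1})^k.
--
-- Nonskip monomials are not.  A monomial m with exponents < k is nonskip iff, scanning from x_n
-- down to x_1 with a counter c that starts at 0 and increases at each exponent a ≤ c, the
-- counter reaches k.  Following this scan backwards from the evaluation at 0, one builds a
-- functional which kills J_{n,k} and all monomials below m, and has value 1 on m; so m is not
-- the initial monomial of an element of J_{n,k}.  A step with a ≤ c is the transpose of
-- a composite of a divided differences; a step with a > c composes c divided differences with
-- the extraction of a coefficient in the last variable modulo a complete homogeneous
-- polynomial.

open import Defs
open import Level using (Level; _⊔_)
open import Data.Nat as ℕ using (ℕ; zero; suc; _≤_; _<_; _∸_; z≤n; s≤s)
import Data.Nat.Properties as ℕₚ
open import Data.Bool using (Bool; true; false; if_then_else_)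
open import Data.Fin as Fin using (Fin; toℕ; fromℕ; inject₁; opposite)
import Data.Fin.Properties as Finₚ
open import Data.Fin.Subset using (Subset; ∣_∣)
open import Data.Vec as Vec using (Vec; []; _∷_; lookup)
import Data.Vec.Properties as Vecₚ
open import Data.Vec.Properties using (≡-dec)
open import Data.List as List using (List; []; _∷_; _++_; map; concatMap; length; zipWith; downFrom; upTo)
import Data.List.Properties as Listₚ
open import Data.List.Membership.Propositional using (_∈_)
import Data.List.Membership.Propositional.Properties as ∈ₚ
open import Data.List.Relation.Unary.Any using (here; there)
open import Data.List.Relation.Unary.All as All using (All; []; _∷_)
import Data.List.Relation.Unary.All.Properties as Allₚ
open import Data.List.Relation.Binary.Permutation.Propositional as ↭ using (_↭_)
import Data.List.Relation.Binary.Permutation.Propositional.Properties as ↭ₚ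
open import Data.Unit using (⊤; tt)
open import Data.Product using (Σ; _×_; _,_; proj₁; proj₂)
open import Data.Sum using (_⊎_; inj₁; inj₂)
open import Data.Empty using (⊥; ⊥-elim)
open import Function.Bundles using (_⇔_; mk⇔)
open import Relation.Nullary using (¬_; yes; no)
open import Relation.Binary.Definitions using (tri<; tri≈; tri>)
open import Relation.Binary.PropositionalEquality as ≡ using (_≡_; _≢_)

-- No dimension of the quotient is computed: the two inclusions are independent. The rule of the
-- scan comes from the number of variables available. When x_1, ..., x_l have been treated, the
-- ideal involves l + c variables, where c is the counter of the remaining exponents. Composing a
-- functional with a divided difference raises its leading exponent by 1 and moves it one variable
-- towards x_1. So exponent a at x_{l+1}, obtained from exponent 0, needs all variables up to
-- x_{l+1+a}. At a stair these are among the l + c variables, and one surplus variable is used up.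
-- Otherwise a new variable is adjoined with exponent a - c, and c divided differences do the rest.
-- The bound a < k enters because a divided difference trades a complete homogeneous polynomial for
-- one of degree one less in one more variable, and this degree must not drop to 0.

module Monomials where

  open ≡ using (refl; cong; cong₂; subst)
  open import Data.Vec using (_∷ʳ_; reverse; tabulate)

  private variable
    n : ℕ

  -- Exponent vectors.

  0s : ∀ {n} → Monomial n
  0s = Vec.replicate _ 0

  -- Index i stands for the variable x_{i+1}.
  bump : ∀ {n} → ℕ → Monomial n → Monomial n
  bump i       []      = []
  bump zero    (x ∷ v) = suc x ∷ v
  bump (suc i) (x ∷ v) = x ∷ bump i v

  bump-comm : ∀ {n} i j (v : Monomial n) → bump i (bump j v) ≡ bump j (bump i v)
  bump-comm i       j       []      = refl
  bump-comm zero    zero    (x ∷ v) = refl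
  bump-comm zero    (suc j) (x ∷ v) = refl
  bump-comm (suc i) zero    (x ∷ v) = refl
  bump-comm (suc i) (suc j) (x ∷ v) = cong (x ∷_) (bump-comm i j v)

  infixl 6 _⊕_
  _⊕_ : ∀ {n} → Monomial n → Monomial n → Monomial n
  _⊕_ = Vec.zipWith ℕ._+_

  -- Out of range, the exponent is 0.
  at : ∀ {n} → ℕ → Monomial n → ℕ
  at i       []      = 0
  at zero    (x ∷ v) = x
  at (suc i) (x ∷ v) = at i v

  at-toℕ : ∀ {n} (i : Fin n) (v : Monomial n) → at (toℕ i) v ≡ lookup v i
  at-toℕ Fin.zero    (x ∷ v) = refl
  at-toℕ (Fin.suc i) (x ∷ v) = at-toℕ i v

  put : ∀ {n} → ℕ → ℕ → Monomial n → Monomial n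
  put i       y []      = []
  put zero    y (x ∷ v) = y ∷ v
  put (suc i) y (x ∷ v) = x ∷ put i y v

  trunc : ∀ {n} → ℕ → Monomial n → Monomial n
  trunc zero    v       = 0s
  trunc (suc l) []      = []
  trunc (suc l) (x ∷ v) = x ∷ trunc l v

  trunc-suc : ∀ {n} l (v : Monomial n) → trunc (suc l) v ≡ put l (at l v) (trunc l v)
  trunc-suc zero    []      = refl
  trunc-suc zero    (x ∷ v) = refl
  trunc-suc (suc l) []      = refl
  trunc-suc (suc l) (x ∷ v) = cong (x ∷_) (trunc-suc l v)

  trunc-full : ∀ {n} (v : Monomial n) → trunc n v ≡ v
  trunc-full []      = refl
  trunc-full (x ∷ v) = cong (x ∷_) (trunc-full v)

  trunc-suc-put-zero : ∀ {n} l (v : Monomial n) → trunc (suc l) (put l 0 v) ≡ trunc l v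
  trunc-suc-put-zero zero    []      = refl
  trunc-suc-put-zero zero    (x ∷ v) = refl
  trunc-suc-put-zero (suc l) []      = refl
  trunc-suc-put-zero (suc l) (x ∷ v) = cong (x ∷_) (trunc-suc-put-zero l v)

  -- The neglex order.

  infix 4 _≺_
  -- The last variable is the largest, so tails are compared before heads. This recursive form of
  -- `_<nl_` lets proofs go by induction on the vector.
  data _≺_ : ∀ {n} → Monomial n → Monomial n → Set where
    here  : ∀ {n a b} {v : Monomial n} → a < b → a ∷ v ≺ b ∷ v
    there : ∀ {n a b} {v w : Monomial n} → v ≺ w → a ∷ v ≺ b ∷ w

  ≺-irrefl : ∀ {n} {v : Monomial n} → ¬ v ≺ v
  ≺-irrefl (here p)  = ℕₚ.n≮n _ p
  ≺-irrefl (there p) = ≺-irrefl p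

  ≺-asym : ∀ {n} {v w : Monomial n} → v ≺ w → ¬ w ≺ v
  ≺-asym (here p)  (here q)  = ℕₚ.<-asym p q
  ≺-asym (here p)  (there q) = ≺-irrefl q
  ≺-asym (there p) (here q)  = ≺-irrefl p
  ≺-asym (there p) (there q) = ≺-asym p q

  ≺-cmp : ∀ {n} (v w : Monomial n) → v ≺ w ⊎ v ≡ w ⊎ w ≺ v
  ≺-cmp [] [] = inj₂ (inj₁ refl)
  ≺-cmp (a ∷ v) (b ∷ w) with ≺-cmp v w
  ... | inj₁ p        = inj₁ (there p)
  ... | inj₂ (inj₂ p) = inj₂ (inj₂ (there p))
  ... | inj₂ (inj₁ refl) with ℕₚ.<-cmp a b
  ...   | tri< p _ _    = inj₁ (here p)
  ...   | tri≈ _ refl _ = inj₂ (inj₁ refl)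
  ...   | tri> _ _ p    = inj₂ (inj₂ (here p))

  vec-ext : ∀ {n} {v w : Monomial n} → (∀ i → lookup v i ≡ lookup w i) → v ≡ w
  vec-ext {v = []}    {[]}    p = refl
  vec-ext {v = a ∷ v} {b ∷ w} p = cong₂ _∷_ (p Fin.zero) (vec-ext (λ i → p (Fin.suc i)))

  ≺⇒<nl : ∀ {n} {v w : Monomial n} → v ≺ w → v <nl w
  ≺⇒<nl (here p)  = Fin.zero , p , λ { (Fin.suc j) _ → refl }
  ≺⇒<nl (there p) with ≺⇒<nl p
  ... | j , q , r = Fin.suc j , q , λ { (Fin.suc j') (s≤s s) → r j' s }

  <nl⇒≺ : ∀ {n} {v w : Monomial n} → v <nl w → v ≺ w
  <nl⇒≺ {v = a ∷ v} {b ∷ w} (Fin.zero , p , r)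
    rewrite vec-ext {v = v} {w} (λ i → r (Fin.suc i) (s≤s z≤n)) = here p
  <nl⇒≺ {v = a ∷ v} {b ∷ w} (Fin.suc j , p , r) =
    there (<nl⇒≺ (j , p , λ j' q → r (Fin.suc j') (s≤s q)))

  ≺-inv : ∀ {n a b} {v w : Monomial n} → a ∷ v ≺ b ∷ w → v ≺ w ⊎ (v ≡ w × a < b)
  ≺-inv (here p)  = inj₂ (refl , p)
  ≺-inv (there p) = inj₁ p

  put-injective : ∀ {n p} {x a} (v w : Monomial n) → p < n →
    put p x (trunc p v) ≡ put p a (trunc p w) → x ≡ a × trunc p v ≡ trunc p w
  put-injective {p = zero}  (y ∷ v) (z ∷ w) _       e = cong (at 0) e , refl
  put-injective {p = suc p} (y ∷ v) (z ∷ w) (s≤s q) e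
    with put-injective v w q (cong Vec.tail e)
  ... | x≡a , e' = x≡a , cong₂ _∷_ (cong (at 0) e) e'

  put-≺ : ∀ {n p} {x a} (v w : Monomial n) → p < n →
    put p x (trunc p v) ≺ put p a (trunc p w) → x < a ⊎ (x ≡ a × trunc p v ≺ trunc p w)
  put-≺ {p = zero} (y ∷ v) (z ∷ w) _ q with ≺-inv q
  ... | inj₁ r       = ⊥-elim (≺-irrefl r)
  ... | inj₂ (_ , r) = inj₁ r
  put-≺ {p = suc p} (y ∷ v) (z ∷ w) (s≤s l) q with ≺-inv q
  ... | inj₂ (e , y<z) with put-injective v w l e
  ...   | x≡a , e' rewrite e' = inj₂ (x≡a , here y<z)
  put-≺ {p = suc p} (y ∷ v) (z ∷ w) (s≤s l) q | inj₁ r with put-≺ v w l r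
  ... | inj₁ x<a      = inj₁ x<a
  ... | inj₂ (e , r') = inj₂ (e , there r')

  put-zero-trunc : ∀ {n} p (v : Monomial n) → put p 0 (trunc p v) ≡ trunc p v
  put-zero-trunc zero    []      = refl
  put-zero-trunc zero    (x ∷ v) = refl
  put-zero-trunc (suc p) []      = refl
  put-zero-trunc (suc p) (x ∷ v) = cong (x ∷_) (put-zero-trunc p v)

  -- A monomial with all exponents < k is (n,k)-reverse nonskip iff its number of stairs is ≥ k.
  climb : ℕ → ℕ → ℕ
  climb a c with a ℕ.≤? c
  ... | yes _ = suc c
  ... | no _  = c

  climb≤ : ∀ a c → climb a c ≤ suc c
  climb≤ a c with a ℕ.≤? c
  ... | yes _ = ℕₚ.≤-refl
  ... | no _  = ℕₚ.n≤1+n c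

  stairs : ∀ {n} → Monomial n → ℕ
  stairs []      = 0
  stairs (a ∷ m) = climb a (stairs m)

  stairsFrom : ∀ {n} → ℕ → Monomial n → ℕ
  stairsFrom zero    m       = stairs m
  stairsFrom (suc l) []      = 0
  stairsFrom (suc l) (a ∷ m) = stairsFrom l m

  stairsFrom-climb : ∀ {n} l (m : Monomial n) → l < n →
    stairsFrom l m ≡ climb (at l m) (stairsFrom (suc l) m)
  stairsFrom-climb zero    (a ∷ m) _       = refl
  stairsFrom-climb (suc l) (a ∷ m) (s≤s p) = stairsFrom-climb l m p

  stairsFrom-end : ∀ {n} (m : Monomial n) → stairsFrom n m ≡ 0
  stairsFrom-end []      = refl
  stairsFrom-end (a ∷ m) = stairsFrom-end m

  stairs≤ : ∀ {n} (m : Monomial n) → stairs m ≤ n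
  stairs≤ []      = z≤n
  stairs≤ (a ∷ m) = ℕₚ.≤-trans (climb≤ a (stairs m)) (s≤s (stairs≤ m))

  stairsFrom≤ : ∀ {n} l (m : Monomial n) → l ≤ n → l ℕ.+ stairsFrom l m ≤ n
  stairsFrom≤ zero    m       _       = stairs≤ m
  stairsFrom≤ (suc l) (a ∷ m) (s≤s p) = s≤s (stairsFrom≤ l m p)

  -- A higher degree makes up for one variable fewer: the bound for degree d in l + 1 + c variables
  -- yields the bound for degree e > d in l + c variables. For c = 0 the truncated difference is 0
  -- and k ≤ d < e suffices.
  ≤-degree-shift : ∀ {k d e} l c → k ≤ d ℕ.+ c → d < e → k ≤ e ℕ.+ (l ℕ.+ c ∸ suc l)
  ≤-degree-shift {k} {d} {e} l c k≤d+c d<e = begin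
    k                            ≤⟨ k≤d+c ⟩
    d ℕ.+ c                      ≤⟨ ℕₚ.+-monoʳ-≤ d (ℕₚ.m≤n+m∸n c 1) ⟩
    d ℕ.+ suc (c ∸ 1)            ≡⟨ ℕₚ.+-suc d (c ∸ 1) ⟩
    suc d ℕ.+ (c ∸ 1)            ≤⟨ ℕₚ.+-monoˡ-≤ (c ∸ 1) d<e ⟩
    e ℕ.+ (c ∸ 1)                ≡⟨ cong (e ℕ.+_) (ℕₚ.[m+n]∸[m+o]≡n∸o l c 1) ⟨
    e ℕ.+ (l ℕ.+ c ∸ (l ℕ.+ 1))  ≡⟨ cong (λ x → e ℕ.+ (l ℕ.+ c ∸ x)) (ℕₚ.+-comm l 1) ⟩
    e ℕ.+ (l ℕ.+ c ∸ suc l)      ∎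
    where open ℕₚ.≤-Reasoning

  -- Skip monomials and characteristic vectors.

  zeros : Vec Bool n → ℕ
  zeros []          = 0
  zeros (true ∷ b)  = zeros b
  zeros (false ∷ b) = suc (zeros b)

  -- The reverse skip monomial of S is skipMon 0 of the reversed characteristic vector of S:
  -- for s = s_j the exponent s_j - j + 1 counts the t < s outside S, which come after
  -- position n - s + 1.
  skipMon : ℕ → Vec Bool n → Monomial n
  skipMon c []          = []
  skipMon c (true ∷ b)  = suc (c ℕ.+ zeros b) ∷ skipMon c b
  skipMon c (false ∷ b) = 0 ∷ skipMon c b

  -- The same exponents read in the order of S, with c counting the numbers outside S passed so far;
  -- at s_j this count is s_j - j.
  skipMonʳ : ℕ → Vec Bool n → Monomial n
  skipMonʳ c []          = []
  skipMonʳ c (true ∷ S)  = suc c ∷ skipMonʳ c S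
  skipMonʳ c (false ∷ S) = 0 ∷ skipMonʳ (suc c) S

  zeros-∷ʳ-true : ∀ (b : Vec Bool n) → zeros (b ∷ʳ true) ≡ zeros b
  zeros-∷ʳ-true []          = refl
  zeros-∷ʳ-true (true ∷ b)  = zeros-∷ʳ-true b
  zeros-∷ʳ-true (false ∷ b) = cong suc (zeros-∷ʳ-true b)

  zeros-∷ʳ-false : ∀ (b : Vec Bool n) → zeros (b ∷ʳ false) ≡ suc (zeros b)
  zeros-∷ʳ-false []          = refl
  zeros-∷ʳ-false (true ∷ b)  = zeros-∷ʳ-false b
  zeros-∷ʳ-false (false ∷ b) = cong suc (zeros-∷ʳ-false b)

  zeros-reverse : ∀ (b : Vec Bool n) → zeros (reverse b) ≡ zeros b
  zeros-reverse []          = refl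
  zeros-reverse (true ∷ b)  rewrite Vecₚ.reverse-∷ true b | zeros-∷ʳ-true (reverse b) =
      zeros-reverse b
  zeros-reverse (false ∷ b) rewrite Vecₚ.reverse-∷ false b | zeros-∷ʳ-false (reverse b) =
      cong suc (zeros-reverse b)

  skipMon-∷ʳ-true : ∀ c (b : Vec Bool n) → skipMon c (b ∷ʳ true) ≡ skipMon c b ∷ʳ suc c
  skipMon-∷ʳ-true c []          = cong (λ x → suc x ∷ []) (ℕₚ.+-identityʳ c)
  skipMon-∷ʳ-true c (true ∷ b)  = cong₂ (λ z v → suc (c ℕ.+ z) ∷ v) (zeros-∷ʳ-true b)
      (skipMon-∷ʳ-true c b)
  skipMon-∷ʳ-true c (false ∷ b) = cong (0 ∷_) (skipMon-∷ʳ-true c b)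

  skipMon-∷ʳ-false : ∀ c (b : Vec Bool n) → skipMon c (b ∷ʳ false) ≡ skipMon (suc c) b ∷ʳ 0
  skipMon-∷ʳ-false c []          = refl
  skipMon-∷ʳ-false c (true ∷ b)  =
    cong₂ (λ z v → suc z ∷ v) (≡.trans (cong (c ℕ.+_) (zeros-∷ʳ-false b)) (ℕₚ.+-suc c _))
        (skipMon-∷ʳ-false c b)
  skipMon-∷ʳ-false c (false ∷ b) = cong (0 ∷_) (skipMon-∷ʳ-false c b)

  skipMon-reverse : ∀ c (S : Vec Bool n) → skipMon c (reverse S) ≡ reverse (skipMonʳ c S)
  skipMon-reverse c []          = refl
  skipMon-reverse c (true ∷ S)
    rewrite Vecₚ.reverse-∷ true S | skipMon-∷ʳ-true c (reverse S) |
        Vecₚ.reverse-∷ (suc c) (skipMonʳ c S) =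
    cong (_∷ʳ suc c) (skipMon-reverse c S)
  skipMon-reverse c (false ∷ S)
    rewrite Vecₚ.reverse-∷ false S | skipMon-∷ʳ-false c (reverse S) |
        Vecₚ.reverse-∷ 0 (skipMonʳ (suc c) S) =
    cong (_∷ʳ 0) (skipMon-reverse (suc c) S)

  countBelow≤ : ∀ (S : Subset n) i → countBelow S i ≤ toℕ i
  countBelow≤ (b ∷ S)     Fin.zero    = z≤n
  countBelow≤ (true ∷ S)  (Fin.suc i) = s≤s (countBelow≤ S i)
  countBelow≤ (false ∷ S) (Fin.suc i) = ℕₚ.m≤n⇒m≤1+n (countBelow≤ S i)

  lookup-skipMonʳ : ∀ c (S : Subset n) i →
    lookup (skipMonʳ c S) i ≡ (if lookup S i then c ℕ.+ (suc (toℕ i) ∸ countBelow S i) else 0)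
  lookup-skipMonʳ c (true ∷ S)  Fin.zero    = ℕₚ.+-comm 1 c
  lookup-skipMonʳ c (false ∷ S) Fin.zero    = refl
  lookup-skipMonʳ c (true ∷ S)  (Fin.suc i) = lookup-skipMonʳ c S i
  lookup-skipMonʳ c (false ∷ S) (Fin.suc i) rewrite lookup-skipMonʳ (suc c) S i with lookup S i
  ... | false = refl
  ... | true  = ≡.trans (≡.sym (ℕₚ.+-suc c _))
    (cong (c ℕ.+_) (≡.sym (ℕₚ.+-∸-assoc 1 (ℕₚ.m≤n⇒m≤1+n (countBelow≤ S i)))))

  revSkipExp-skipMonʳ : ∀ (S : Subset n) i → revSkipExp S i ≡ lookup (skipMonʳ 0 S) i
  revSkipExp-skipMonʳ S i rewrite lookup-skipMonʳ 0 S i with lookup S i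
  ... | true  = refl
  ... | false = refl

  lookup-∷ʳ-fromℕ : ∀ {A : Set} (v : Vec A n) x → lookup (v ∷ʳ x) (fromℕ n) ≡ x
  lookup-∷ʳ-fromℕ []      x = refl
  lookup-∷ʳ-fromℕ (y ∷ v) x = lookup-∷ʳ-fromℕ v x

  lookup-∷ʳ-inject₁ : ∀ {A : Set} (v : Vec A n) x i → lookup (v ∷ʳ x) (inject₁ i) ≡ lookup v i
  lookup-∷ʳ-inject₁ (y ∷ v) x Fin.zero    = refl
  lookup-∷ʳ-inject₁ (y ∷ v) x (Fin.suc i) = lookup-∷ʳ-inject₁ v x i

  tabulate-opposite : ∀ {A : Set} (v : Vec A n) → tabulate (λ i → lookup v (opposite i)) ≡ reverse v
  tabulate-opposite {zero}  [] = refl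
  tabulate-opposite {suc n} v with Vec.initLast v
  ... | w , x , refl = ≡.trans
    (cong₂ _∷_ (lookup-∷ʳ-fromℕ w x)
      (≡.trans (Vecₚ.tabulate-cong (λ i → lookup-∷ʳ-inject₁ w x (opposite i)))
          (tabulate-opposite w)))
    (≡.sym (Vecₚ.reverse-reverse
      (≡.trans (Vecₚ.reverse-∷ x (reverse w)) (cong (_∷ʳ x) (Vecₚ.reverse-involutive w)))))

  revSkip-skipMon : ∀ (S : Subset n) → revSkip S ≡ skipMon 0 (reverse S)
  revSkip-skipMon S = ≡.trans (Vecₚ.tabulate-cong (λ i → revSkipExp-skipMonʳ S (opposite i)))
    (≡.trans (tabulate-opposite (skipMonʳ 0 S)) (≡.sym (skipMon-reverse 0 S)))

  ∣b∣+zeros : ∀ (b : Vec Bool n) → ∣ b ∣ ℕ.+ zeros b ≡ n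
  ∣b∣+zeros []          = refl
  ∣b∣+zeros (true ∷ b)  = cong suc (∣b∣+zeros b)
  ∣b∣+zeros (false ∷ b) = ≡.trans (ℕₚ.+-suc ∣ b ∣ (zeros b)) (cong suc (∣b∣+zeros b))

  zeros≤ : ∀ (b : Vec Bool n) → zeros b ≤ n
  zeros≤ b = ℕₚ.≤-trans (ℕₚ.m≤n+m (zeros b) ∣ b ∣) (ℕₚ.≤-reflexive (∣b∣+zeros b))

  ∣reverse∣ : ∀ (b : Vec Bool n) → ∣ reverse b ∣ ≡ ∣ b ∣
  ∣reverse∣ b = ℕₚ.+-cancelʳ-≡ (zeros b) ∣ reverse b ∣ ∣ b ∣
    (≡.trans (cong (∣ reverse b ∣ ℕ.+_) (≡.sym (zeros-reverse b)))
      (≡.trans (∣b∣+zeros (reverse b)) (≡.sym (∣b∣+zeros b))))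

  ∣ₘ-∷ : ∀ {x y} (v w : Monomial n) → x ≤ y → v ∣ₘ w → (x ∷ v) ∣ₘ (y ∷ w)
  ∣ₘ-∷ v w p q Fin.zero    = p
  ∣ₘ-∷ v w p q (Fin.suc i) = q i

  -- A position is marked exactly when it is not a stair. The unmarked positions after it number
  -- `stairs` of the tail, and a non-stair has exponent at least one more than that, which is what
  -- `skipMon` demands.
  greedy : ∀ (m : Monomial n) → Σ (Vec Bool n) λ b → zeros b ≡ stairs m × (skipMon 0 b ∣ₘ m)
  greedy []      = [] , refl , λ ()
  greedy (a ∷ m) with greedy m
  ... | b , e , p with a ℕ.≤? stairs m
  ...   | yes _  = false ∷ b , cong suc e , ∣ₘ-∷ (skipMon 0 b) m z≤n p
  ...   | no a≰s = true ∷ b , e , ∣ₘ-∷ (skipMon 0 b) m (subst (_< a) (≡.sym e) (ℕₚ.≰⇒> a≰s)) p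

  -- Marks are removed from the front. An exponent of `skipMon` depends only on the unmarked
  -- positions after it, so the exponents at the surviving marks do not change.
  trim : ∀ r (b : Vec Bool n) m → r ≤ ∣ b ∣ → skipMon 0 b ∣ₘ m →
    Σ (Vec Bool n) λ b′ → ∣ b′ ∣ ≡ r × (skipMon 0 b′ ∣ₘ m)
  trim zero    []          m _ p = [] , refl , p
  trim r       (false ∷ b) (x ∷ m) r≤ p with trim r b m r≤ (λ i → p (Fin.suc i))
  ... | b′ , e , q = false ∷ b′ , e , ∣ₘ-∷ (skipMon 0 b′) m z≤n q
  trim r       (true ∷ b)  (x ∷ m) r≤ p with r ℕ.≟ suc ∣ b ∣
  ... | yes refl = true ∷ b , refl , p
  ... | no r≢ with trim r b m (ℕₚ.≤-pred (ℕₚ.≤∧≢⇒< r≤ r≢)) (λ i → p (Fin.suc i))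
  ...   | b′ , e , q = false ∷ b′ , e , ∣ₘ-∷ (skipMon 0 b′) m z≤n q

  nonskip⇒stairs : ∀ n k → k ≤ n → (m : Monomial n) → ReverseNonskip n k m → k ≤ stairs m
  nonskip⇒stairs n k k≤n m (_ , nonskip) with k ℕ.≤? stairs m
  ... | yes p = p
  ... | no  p with greedy m
  ...   | b , e , d with trim (n ∸ k ℕ.+ 1) b m many d
    where
    many : n ∸ k ℕ.+ 1 ≤ ∣ b ∣
    many = ℕₚ.+-cancelʳ-≤ (zeros b) _ _ (begin
      n ∸ k ℕ.+ 1 ℕ.+ zeros b     ≡⟨ ℕₚ.+-assoc (n ∸ k) 1 (zeros b) ⟩
      n ∸ k ℕ.+ suc (zeros b)     ≤⟨ ℕₚ.+-monoʳ-≤ (n ∸ k) (subst (_< k) (≡.sym e) (ℕₚ.≰⇒> p)) ⟩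
      n ∸ k ℕ.+ k                 ≡⟨ ℕₚ.m∸n+n≡m k≤n ⟩
      n                           ≡⟨ ∣b∣+zeros b ⟨
      ∣ b ∣ ℕ.+ zeros b           ∎)
      where open ℕₚ.≤-Reasoning
  ...     | b′ , r , q = ⊥-elim (nonskip (reverse b′) (≡.trans (∣reverse∣ b′) r)
    (subst (_∣ₘ m) (≡.sym (≡.trans (revSkip-skipMon (reverse b′))
        (cong (skipMon 0) (Vecₚ.reverse-involutive b′)))) q))

  nonskip⇒small : ∀ {n k} {m : Monomial n} → ReverseNonskip n k m → ∀ l → l < n → at l m < k
  nonskip⇒small {m = m} (small , _) l l<n = subst (_< _)
    (≡.trans (≡.sym (at-toℕ (Fin.fromℕ< l<n) m)) (cong (λ i → at i m) (toℕ-fromℕ< l<n)))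
    (ℕₚ.≰⇒> (small (Fin.fromℕ< l<n)))
    where open import Data.Fin.Properties using (toℕ-fromℕ<)

  -- Bubbling ones towards the last variable.
  data Swap : ℕ → Vec Bool n → Vec Bool n → Set where
    here  : ∀ {b : Vec Bool n} → Swap 0 (true ∷ false ∷ b) (false ∷ true ∷ b)
    there : ∀ {x i} {b b′ : Vec Bool n} → Swap i b b′ → Swap (suc i) (x ∷ b) (x ∷ b′)

  zeros-swap : ∀ {i} {b b′ : Vec Bool n} → Swap i b b′ → zeros b ≡ zeros b′
  zeros-swap here                  = refl
  zeros-swap (there {x = true} s)  = zeros-swap s
  zeros-swap (there {x = false} s) = cong suc (zeros-swap s)

  swap-inRange : ∀ {i} {b b′ : Vec Bool n} → Swap i b b′ → suc i < n
  swap-inRange here      = s≤s (s≤s z≤n)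
  swap-inRange (there s) = s≤s (swap-inRange s)

  sorted : ∀ n → ℕ → Vec Bool n
  sorted zero    z = []
  sorted (suc n) z with z ℕ.≤? n
  ... | yes _ = true ∷ sorted n z
  ... | no  _ = false ∷ sorted n (ℕ.pred z)

  module _ {a : Level} where

    Closed : (Vec Bool n → Set a) → Set a
    Closed P = ∀ {i b b′} → Swap i b b′ → P b → P b′

    -- The first `false` of the sorted word travels to the front, by one swap for each `true` that
    -- it passes.
    rotate : ∀ n z → z ≤ n → (P : Vec Bool (suc n) → Set a) → Closed P →
      P (sorted (suc n) (suc z)) → P (false ∷ sorted n z)
    rotate n z l P cl p with suc z ℕ.≤? n
    rotate n z l P cl p | no _ = p
    rotate (suc n) z _ P cl p | yes (s≤s l) with z ℕ.≤? n
    ... | no q = ⊥-elim (q l)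
    ... | yes _  = cl here (rotate n z l (λ b → P (true ∷ b)) (λ s → cl (there s)) p)

    bubble : ∀ (b : Vec Bool n) (P : Vec Bool n → Set a) → Closed P → P (sorted n (zeros b)) → P b
    bubble []                  P cl p = p
    bubble {suc n} (true ∷ b)  P cl p with zeros b ℕ.≤? n
    ... | yes _ = bubble b (λ b′ → P (true ∷ b′)) (λ s → cl (there s)) p
    ... | no q  = ⊥-elim (q (zeros≤ b))
    bubble {suc n} (false ∷ b) P cl p =
      bubble b (λ b′ → P (false ∷ b′)) (λ s → cl (there s)) (rotate n (zeros b) (zeros≤ b) P cl p)

  zeros-of-size : ∀ {n} z (S : Subset n) → z < n → ∣ S ∣ ≡ n ∸ suc z ℕ.+ 1 → zeros S ≡ z
  zeros-of-size {n} z S z<n size = ℕₚ.suc-injective (ℕₚ.+-cancelˡ-≡ (n ∸ suc z) _ _ (begin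
    n ∸ suc z ℕ.+ suc (zeros S)    ≡⟨ ℕₚ.+-assoc (n ∸ suc z) 1 (zeros S) ⟨
    n ∸ suc z ℕ.+ 1 ℕ.+ zeros S    ≡⟨ cong (ℕ._+ zeros S) size ⟨
    ∣ S ∣ ℕ.+ zeros S              ≡⟨ ∣b∣+zeros S ⟩
    n                              ≡⟨ ℕₚ.m∸n+n≡m z<n ⟨
    n ∸ suc z ℕ.+ suc z            ∎))
    where open ≡.≡-Reasoning

open Monomials

module Polynomials {c ℓ} (F : Field c ℓ) where

  open Field F hiding (zero)
  open import Relation.Binary.Reasoning.Setoid setoid
  open import Algebra.Properties.CommutativeSemigroup +-commutativeSemigroup using
      (interchange; x∙yz≈y∙xz)
  open import Algebra.Properties.Ring ring using
      (-0#≈0#; -‿+-comm; -‿distribʳ-*; -‿distribˡ-*; +-cancelʳ; \\-leftDividesˡ)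

  private variable
    n k : ℕ

  -- Linear functionals and transposed multiplications.

  0+0 : ∀ {x y} → x ≈ 0# → y ≈ 0# → x + y ≈ 0#
  0+0 p q = trans (+-cong p q) (+-identityʳ 0#)

  -- The linear functionals on polynomials, given by their values on monomials; X i is the
  -- transpose of multiplication by the variable with index i.
  Dual : ℕ → Set c
  Dual n = Monomial n → Carrier

  X : ℕ → Dual n → Dual n
  X i f v = f (bump i v)

  infix 4 _≐_
  _≐_ : Dual n → Dual n → Set ℓ
  f ≐ g = ∀ v → f v ≈ g v

  Vanishes : Dual n → Set ℓ
  Vanishes f = ∀ v → f v ≈ 0#

  infixl 6 _⊞_
  _⊞_ : Dual n → Dual n → Dual n
  (f ⊞ g) v = f v + g v

  -- Transposes of multiplication by the complete homogeneous (H), the elementary (E) and the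
  -- signed elementary (Es) symmetric polynomials in the variables with indices in a list.
  H : List ℕ → ℕ → Dual n → Dual n
  H L       zero    f = f
  H []      (suc d) f = λ _ → 0#
  H (x ∷ L) (suc d) f = λ v → H L (suc d) f v + H (x ∷ L) d f (bump x v)

  E : List ℕ → ℕ → Dual n → Dual n
  E L       zero    f = f
  E []      (suc j) f = λ _ → 0#
  E (x ∷ L) (suc j) f = λ v → E L (suc j) f v + E L j f (bump x v)

  Es : List ℕ → ℕ → Dual n → Dual n
  Es L       zero    f = f
  Es []      (suc j) f = λ _ → 0#
  Es (x ∷ L) (suc j) f = λ v → Es L (suc j) f v - Es L j f (bump x v)

  -- The index set I allows operators such as `coefT`, which assemble one functional from a family
  -- of them. S collects the variables whose multiplication commutes with T; symmetric polynomials
  -- in such variables then commute with T as well.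
  record Linear {I : Set} (S : ℕ → Set) (T : (I → Dual n) → Dual n) : Set (c ⊔ ℓ) where
    field
      T-cong : ∀ {g h} → (∀ i → g i ≐ h i) → T g ≐ T h
      T-⊞    : ∀ g h → T (λ i → g i ⊞ h i) ≐ T g ⊞ T h
      T-X    : ∀ {x} → S x → ∀ g → X x (T g) ≐ T (λ i → X x (g i))

    T-0 : T (λ _ _ → 0#) ≐ (λ _ → 0#)
    T-0 v = sym (begin
      0#              ≈⟨ -‿inverseʳ z ⟨
      z - z           ≈⟨ +-congʳ (trans (T-cong (λ _ _ → sym (+-identityʳ 0#)) v)
          (T-⊞ (λ _ _ → 0#) (λ _ _ → 0#) v)) ⟩
      z + z - z       ≈⟨ +-assoc z z (- z) ⟩
      z + (z - z)     ≈⟨ +-congˡ (-‿inverseʳ z) ⟩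
      z + 0#          ≈⟨ +-identityʳ z ⟩
      z               ∎)
      where z = T (λ _ _ → 0#) v

    T-vanishes : ∀ {g} → (∀ i → Vanishes (g i)) → Vanishes (T g)
    T-vanishes p v = trans (T-cong p v) (T-0 v)

    H-T : ∀ {L} → All S L → ∀ d g → H L d (T g) ≐ T (λ i → H L d (g i))
    H-T p        zero    g v = refl
    H-T []       (suc d) g v = sym (T-0 v)
    H-T (s ∷ p)  (suc d) g v = trans
      (+-cong (H-T p (suc d) g v) (trans (H-T (s ∷ p) d g _) (T-X s _ v)))
      (sym (T-⊞ _ _ v))

    E-T : ∀ {L} → All S L → ∀ j g → E L j (T g) ≐ T (λ i → E L j (g i))
    E-T p        zero    g v = refl
    E-T []       (suc j) g v = sym (T-0 v)
    E-T (s ∷ p)  (suc j) g v = trans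
      (+-cong (E-T p (suc j) g v) (trans (E-T p j g _) (T-X s _ v)))
      (sym (T-⊞ _ _ v))

  -- Operators on a single functional are families indexed by the unit type.
  LinearOp : (ℕ → Set) → (Dual n → Dual n) → Set (c ⊔ ℓ)
  LinearOp S T = Linear {I = ⊤} S (λ g → T (g tt))

  everywhere : (L : List ℕ) → All (λ _ → ⊤) L
  everywhere L = All.universal (λ _ → tt) L

  H-cong : ∀ L d {f g : Dual n} → f ≐ g → H L d f ≐ H L d g
  H-cong L       zero    p v = p v
  H-cong []      (suc d) p v = refl
  H-cong (x ∷ L) (suc d) p v = +-cong (H-cong L (suc d) p v) (H-cong (x ∷ L) d p _)

  X-linear : ∀ y → LinearOp {n} (λ _ → ⊤) (X y)
  X-linear y = record
    { T-cong = λ p v → p tt (bump y v)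
    ; T-⊞    = λ g h v → refl
    ; T-X    = λ {x} _ g v → reflexive (≡.cong (g tt) (bump-comm y x v))
    }

  Es-linear : ∀ L q → LinearOp {n} (λ _ → ⊤) (Es L q)
  Es-linear L q = record
    { T-cong = λ p → Es-cong L q (p tt)
    ; T-⊞    = λ g h → Es-⊞ L q (g tt) (h tt)
    ; T-X    = λ {x} _ g → Es-X L q x (g tt)
    }
    where
    Es-cong : ∀ L q {f g : Dual n} → f ≐ g → Es L q f ≐ Es L q g
    Es-cong L       zero    p v = p v
    Es-cong []      (suc q) p v = refl
    Es-cong (x ∷ L) (suc q) p v = +-cong (Es-cong L (suc q) p v) (-‿cong (Es-cong L q p _))
    Es-⊞ : ∀ L q (f g : Dual n) → Es L q (f ⊞ g) ≐ Es L q f ⊞ Es L q g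
    Es-⊞ L       zero    f g v = refl
    Es-⊞ []      (suc q) f g v = sym (+-identityʳ 0#)
    Es-⊞ (x ∷ L) (suc q) f g v = trans
      (+-cong (Es-⊞ L (suc q) f g v) (trans (-‿cong (Es-⊞ L q f g _)) (sym (-‿+-comm _ _))))
      (interchange _ _ _ _)
    Es-X : ∀ L q x (f : Dual n) → X x (Es L q f) ≐ Es L q (X x f)
    Es-X L       zero    x f v = refl
    Es-X []      (suc q) x f v = refl
    Es-X (y ∷ L) (suc q) x f v = +-cong (Es-X L (suc q) x f v) (-‿cong
      (trans (reflexive (≡.cong (Es L q f) (bump-comm y x v))) (Es-X L q x f _)))

  module Xₗ {n} y = Linear (X-linear {n} y)
  module Esₗ {n} L q = Linear (Es-linear {n} L q)

  -- Divided differences: dd i is the transpose of f ↦ (f − sᵢ f) / (xᵢ − xᵢ₊₁).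
  D : (ℕ → ℕ → Carrier) → ℕ → ℕ → Carrier
  D f zero    zero    = 0#
  D f zero    (suc q) = - f 0 q + D (λ s t → f (suc s) t) 0 q
  D f (suc p) q       = f p q + D (λ s t → f s (suc t)) p q

  dd : ℕ → Dual n → Dual n
  dd i       f []          = 0#
  dd zero    f (x ∷ [])    = 0#
  dd zero    f (p ∷ q ∷ v) = D (λ s t → f (s ∷ t ∷ v)) p q
  dd (suc i) f (x ∷ v)     = dd i (λ u → f (x ∷ u)) v

  D-cong : ∀ {f g} p q → (∀ s t → f s t ≈ g s t) → D f p q ≈ D g p q
  D-cong zero    zero    e = refl
  D-cong zero    (suc q) e = +-cong (-‿cong (e 0 q)) (D-cong 0 q (λ s t → e (suc s) t))
  D-cong (suc p) q       e = +-cong (e p q) (D-cong p q (λ s t → e s (suc t)))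

  D-+ : ∀ f g p q → D (λ s t → f s t + g s t) p q ≈ D f p q + D g p q
  D-+ f g zero    zero    = sym (+-identityʳ 0#)
  D-+ f g zero    (suc q) = trans
    (+-cong (sym (-‿+-comm _ _)) (D-+ (λ s t → f (suc s) t) (λ s t → g (suc s) t) 0 q))
    (interchange _ _ _ _)
  D-+ f g (suc p) q       = trans
    (+-congˡ (D-+ (λ s t → f s (suc t)) (λ s t → g s (suc t)) p q)) (interchange _ _ _ _)

  -- In two variables x, y the rules are ∂(x m) = m + y ∂m and ∂(y m) = - m + x ∂m. The definition
  -- of `D` uses the second one only when the exponent of x is 0, so the general case needs an
  -- induction.
  D-sucʳ : ∀ f p q → D f p (suc q) ≈ - f p q + D (λ s t → f (suc s) t) p q
  D-sucʳ f zero    q = refl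
  D-sucʳ f (suc p) q = begin
    f p (suc q) + D (λ s t → f s (suc t)) p (suc q)
      ≈⟨ +-congˡ (D-sucʳ (λ s t → f s (suc t)) p q) ⟩
    f p (suc q) + (- f p (suc q) + r)   ≈⟨ +-assoc _ _ _ ⟨
    f p (suc q) + - f p (suc q) + r     ≈⟨ +-congʳ (-‿inverseʳ _) ⟩
    0# + r                              ≈⟨ +-identityˡ r ⟩
    r                                   ≈⟨ +-identityˡ r ⟨
    0# + r                              ≈⟨ +-congʳ (-‿inverseˡ _) ⟨
    - f (suc p) q + f (suc p) q + r     ≈⟨ +-assoc _ _ _ ⟩
    - f (suc p) q + (f (suc p) q + r)   ∎
    where r = D (λ s t → f (suc s) (suc t)) p q

  dd-bumpˡ : ∀ i (f : Dual n) v → suc i < n → dd i f (bump i v) ≈ f v + dd i (X (suc i) f) v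
  dd-bumpˡ zero    f (p ∷ [])    (s≤s ())
  dd-bumpˡ zero    f (p ∷ q ∷ v) _       = refl
  dd-bumpˡ (suc i) f (x ∷ v)     (s≤s l) = dd-bumpˡ i (λ u → f (x ∷ u)) v l

  dd-bumpʳ : ∀ i (f : Dual n) v → suc i < n → dd i f (bump (suc i) v) ≈ - f v + dd i (X i f) v
  dd-bumpʳ zero    f (p ∷ [])    (s≤s ())
  dd-bumpʳ zero    f (p ∷ q ∷ v) _       = D-sucʳ (λ s t → f (s ∷ t ∷ v)) p q
  dd-bumpʳ (suc i) f (x ∷ v)     (s≤s l) = dd-bumpʳ i (λ u → f (x ∷ u)) v l

  Off : ℕ → ℕ → Set
  Off i x = x ≢ i × x ≢ suc i

  dd-linear : ∀ i → LinearOp {n} (Off i) (dd i)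
  dd-linear i = record
    { T-cong = λ p → dd-cong i (p tt)
    ; T-⊞    = λ g h → dd-⊞ i (g tt) (h tt)
    ; T-X    = λ o g → dd-X i o (g tt)
    }
    where
    dd-cong : ∀ {n} i {f g : Dual n} → f ≐ g → dd i f ≐ dd i g
    dd-cong i       e []          = refl
    dd-cong zero    e (x ∷ [])    = refl
    dd-cong zero    e (p ∷ q ∷ v) = D-cong p q (λ s t → e _)
    dd-cong (suc i) e (x ∷ v)     = dd-cong i (λ u → e _) v
    dd-⊞ : ∀ {n} i (f g : Dual n) → dd i (f ⊞ g) ≐ dd i f ⊞ dd i g
    dd-⊞ i       f g []          = sym (+-identityʳ 0#)
    dd-⊞ zero    f g (x ∷ [])    = sym (+-identityʳ 0#)
    dd-⊞ zero    f g (p ∷ q ∷ v) = D-+ _ _ p q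
    dd-⊞ (suc i) f g (x ∷ v)     = dd-⊞ i _ _ v
    dd-X : ∀ {n} i {x} → Off i x → (f : Dual n) → X x (dd i f) ≐ dd i (X x f)
    dd-X i       o f []      = refl
    dd-X zero    {zero}        o f (p ∷ v)     = ⊥-elim (proj₁ o ≡.refl)
    dd-X zero    {suc zero}    o f (p ∷ v)     = ⊥-elim (proj₂ o ≡.refl)
    dd-X zero    {suc (suc x)} o f (p ∷ [])    = refl
    dd-X zero    {suc (suc x)} o f (p ∷ q ∷ v) = refl
    dd-X (suc i) {zero}        o f (p ∷ v)     = refl
    dd-X (suc i) {suc x}       o f (p ∷ v)     =
      dd-X i ((λ e → proj₁ o (≡.cong suc e)) , (λ e → proj₂ o (≡.cong suc e))) _ v

  module ddₗ {n} i = Linear (dd-linear {n} i)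

  -- Symmetric polynomials under divided differences.

  H-swap : ∀ x y L d (f : Dual n) → H (x ∷ y ∷ L) d f ≐ H (y ∷ x ∷ L) d f
  H-swap x y L zero          f v = refl
  H-swap x y L (suc zero)    f v = trans (+-assoc _ _ _)
      (trans (+-congˡ (+-comm _ _)) (sym (+-assoc _ _ _)))
  H-swap x y L (suc (suc d)) f v = begin
    h + b + H (x ∷ y ∷ L) (suc d) f (bump x v)  ≈⟨ +-congˡ (H-swap x y L (suc d) f _) ⟩
    h + b + (a + H (y ∷ x ∷ L) d f (bump y (bump x v)))
      ≈⟨ +-congˡ (+-congˡ (trans (reflexive (≡.cong (H (y ∷ x ∷ L) d f) (bump-comm y x v)))
           (sym (H-swap x y L d f _)))) ⟩
    h + b + (a + r)                             ≈⟨ interchange h b a r ⟩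
    h + a + (b + r)                             ≈⟨ +-congˡ (H-swap x y L (suc d) f _) ⟩
    h + a + H (y ∷ x ∷ L) (suc d) f (bump y v)  ∎
    where
    h = H L (suc (suc d)) f v
    a = H (x ∷ L) (suc d) f (bump x v)
    b = H (y ∷ L) (suc d) f (bump y v)
    r = H (x ∷ y ∷ L) d f (bump x (bump y v))

  E-swap : ∀ x y L j (f : Dual n) → E (x ∷ y ∷ L) j f ≐ E (y ∷ x ∷ L) j f
  E-swap x y L zero          f v = refl
  E-swap x y L (suc zero)    f v = trans (+-assoc _ _ _)
      (trans (+-congˡ (+-comm _ _)) (sym (+-assoc _ _ _)))
  E-swap x y L (suc (suc j)) f v = trans (interchange _ _ _ _)
    (+-congˡ (+-congˡ (reflexive (≡.cong (E L j f) (bump-comm y x v)))))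

  H-prep : ∀ x {L M} → (∀ d (f : Dual n) → H L d f ≐ H M d f) → ∀ d (f : Dual n) →
      H (x ∷ L) d f ≐ H (x ∷ M) d f
  H-prep x e zero    f v = refl
  H-prep x e (suc d) f v = +-cong (e (suc d) f v) (H-prep x e d f _)

  E-prep : ∀ x {L M} → (∀ j (f : Dual n) → E L j f ≐ E M j f) → ∀ j (f : Dual n) →
      E (x ∷ L) j f ≐ E (x ∷ M) j f
  E-prep x e zero    f v = refl
  E-prep x e (suc j) f v = +-cong (e (suc j) f v) (e j f _)

  H-↭ : ∀ {L M} → L ↭ M → ∀ d (f : Dual n) → H L d f ≐ H M d f
  H-↭ ↭.refl          d f v = refl
  H-↭ (↭.prep x p)    d f v = H-prep x (H-↭ p) d f v
  H-↭ (↭.swap x y p)  d f v = trans (H-swap x y _ d f v) (H-prep y (H-prep x (H-↭ p)) d f v)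
  H-↭ (↭.trans p q)   d f v = trans (H-↭ p d f v) (H-↭ q d f v)

  E-↭ : ∀ {L M} → L ↭ M → ∀ j (f : Dual n) → E L j f ≐ E M j f
  E-↭ ↭.refl          j f v = refl
  E-↭ (↭.prep x p)    j f v = E-prep x (E-↭ p) j f v
  E-↭ (↭.swap x y p)  j f v = trans (E-swap x y _ j f v) (E-prep y (E-prep x (E-↭ p)) j f v)
  E-↭ (↭.trans p q)   j f v = trans (E-↭ p j f v) (E-↭ q j f v)

  downFrom-off : ∀ {i j} → j ≤ i → All (Off i) (downFrom j)
  downFrom-off {j = zero}  _ = []
  downFrom-off {j = suc j} p =
    ((λ { ≡.refl → ℕₚ.n≮n _ p }) , (λ { ≡.refl → ℕₚ.<⇒≱ p (ℕₚ.n≤1+n _) })) ∷ downFrom-off (ℕₚ.<⇒≤ p)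

  module _ (i : ℕ) (i<n : suc i < n) where
    private
      L = downFrom i
      offL : All (Off i) L
      offL = downFrom-off ℕₚ.≤-refl
      H-dd : ∀ d (f : Dual n) → H L d (dd i f) ≐ dd i (H L d f)
      H-dd d f = ddₗ.H-T i offL d (λ _ → f)
      E-dd : ∀ j (f : Dual n) → E L j (dd i f) ≐ dd i (E L j f)
      E-dd j f = ddₗ.E-T i offL j (λ _ → f)

    -- This is the transposed Leibniz rule ∂(g p) = s(g) ∂p + ∂(g) p. For y, z of indices i, i + 1
    -- and g = h_{d+1}(L, y), one has s(g) = h_{d+1}(L, z) and ∂(g) = h_d(L, y, z).
    H-dd-suc : ∀ d (f : Dual n) → H (downFrom (suc i)) (suc d) (dd i f) ≐
      dd i (H (suc i ∷ L) (suc d) f) ⊞ H (downFrom (suc (suc i))) d f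
    H-dd-suc zero f v = begin
      H L 1 (dd i f) v + dd i f (bump i v)     ≈⟨ +-cong (H-dd 1 f v) (dd-bumpˡ i f v i<n) ⟩
      dd i (H L 1 f) v + (f v + dd i (X (suc i) f) v)  ≈⟨ +-congˡ (+-comm _ _) ⟩
      dd i (H L 1 f) v + (dd i (X (suc i) f) v + f v)  ≈⟨ +-assoc _ _ _ ⟨
      dd i (H L 1 f) v + dd i (X (suc i) f) v + f v    ≈⟨ +-congʳ (ddₗ.T-⊞ i _ _ v) ⟨
      dd i (H (suc i ∷ L) 1 f) v + f v                 ∎
    H-dd-suc (suc d) f v = begin
      H L (2 ℕ.+ d) (dd i f) v + H (i ∷ L) (suc d) (dd i f) (bump i v)
        ≈⟨ +-cong (H-dd (2 ℕ.+ d) f v) (H-dd-suc d f (bump i v)) ⟩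
      a + (dd i μ (bump i v) + ρ)          ≈⟨ +-congˡ (+-congʳ (dd-bumpˡ i μ v i<n)) ⟩
      a + (μ v + b + ρ)                    ≈⟨ +-congˡ
          (trans (+-congʳ (+-comm _ _)) (+-assoc _ _ _)) ⟩
      a + (b + (μ v + ρ))                  ≈⟨ +-assoc _ _ _ ⟨
      a + b + (μ v + ρ)                    ≈⟨ +-cong (ddₗ.T-⊞ i _ _ v)
          (trans (H-swap (suc i) i L (suc d) f v) (+-congˡ (H-swap i (suc i) L d f _))) ⟨
      dd i (H (suc i ∷ L) (2 ℕ.+ d) f) v + H (suc i ∷ i ∷ L) (suc d) f v ∎
      where
      a = dd i (H L (2 ℕ.+ d) f) v
      μ = H (suc i ∷ L) (suc d) f
      b = dd i (X (suc i) μ) v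
      ρ = H (suc i ∷ i ∷ L) d f (bump i v)

    -- Symmetry in the two exchanged variables y, z makes the polynomial a scalar for ∂. In
    -- h_{d+1}(L, y) + z h_d(L, y, z) the Leibniz remainders of the two summands are h_d(L, y, z)
    -- with opposite signs and cancel.
    H-dd-suc-suc : ∀ d (f : Dual n) → H (downFrom (2 ℕ.+ i)) d (dd i f) ≐
      dd i (H (downFrom (2 ℕ.+ i)) d f)
    H-dd-suc-suc zero    f v = refl
    H-dd-suc-suc (suc d) f v = begin
      H (i ∷ L) (suc d) (dd i f) v + H (suc i ∷ i ∷ L) d (dd i f) (bump (suc i) v)
        ≈⟨ +-cong (H-dd-suc d f v) (trans (H-dd-suc-suc d f _) (dd-bumpʳ i μ v i<n)) ⟩
      a + μ v + (- μ v + b)     ≈⟨ +-assoc _ _ _ ⟩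
      a + (μ v + (- μ v + b))   ≈⟨ +-congˡ (\\-leftDividesˡ _ _) ⟩
      a + b                     ≈⟨ ddₗ.T-⊞ i _ _ v ⟨
      dd i (H (suc i ∷ L) (suc d) f ⊞ X i μ) v
        ≈⟨ ddₗ.T-cong i (λ _ u → trans (+-congˡ (H-swap (suc i) i L d f _))
            (H-swap i (suc i) L (suc d) f u)) v ⟩
      dd i (H (suc i ∷ i ∷ L) (suc d) f) v ∎
      where
      a = dd i (H (suc i ∷ L) (suc d) f) v
      μ = H (suc i ∷ i ∷ L) d f
      b = dd i (X i μ) v

    E-dd-suc-suc : ∀ j (f : Dual n) → E (downFrom (2 ℕ.+ i)) j (dd i f) ≐
      dd i (E (downFrom (2 ℕ.+ i)) j f)
    E-dd-suc-suc zero f v = refl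
    E-dd-suc-suc (suc zero) f v = begin
      E L 1 (dd i f) v + dd i f (bump i v) + dd i f (bump (suc i) v)
        ≈⟨ +-cong (+-cong (E-dd 1 f v) (dd-bumpˡ i f v i<n)) (dd-bumpʳ i f v i<n) ⟩
      a + (f v + b) + (- f v + b')       ≈⟨ +-congʳ
          (trans (+-congˡ (+-comm _ _)) (sym (+-assoc _ _ _))) ⟩
      a + b + f v + (- f v + b')         ≈⟨ +-assoc _ _ _ ⟩
      a + b + (f v + (- f v + b'))       ≈⟨ +-congˡ (\\-leftDividesˡ _ _) ⟩
      a + b + b'                         ≈⟨ trans (+-assoc _ _ _)
          (trans (+-congˡ (+-comm _ _)) (sym (+-assoc _ _ _))) ⟩
      a + b' + b                         ≈⟨ trans (ddₗ.T-⊞ i _ _ v) (+-congʳ (ddₗ.T-⊞ i _ _ v)) ⟨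
      dd i (E (suc i ∷ i ∷ L) 1 f) v     ∎
      where
      a = dd i (E L 1 f) v
      b = dd i (X (suc i) f) v
      b' = dd i (X i f) v
    E-dd-suc-suc (suc (suc j)) f v = begin
      E L (2 ℕ.+ j) (dd i f) v + E L (suc j) (dd i f) (bump i v) +
          (E L (suc j) (dd i f) (bump (suc i) v) + E L j (dd i f) (bump i (bump (suc i) v)))
        ≈⟨ +-cong (+-cong (E-dd (2 ℕ.+ j) f v) (trans (E-dd (suc j) f _) (dd-bumpˡ i μ v i<n)))
             (+-cong (trans (E-dd (suc j) f _) (dd-bumpʳ i μ v i<n))
               (trans (E-dd j f _) (trans (dd-bumpˡ i κ _ i<n)
                 (trans (+-congˡ (dd-bumpʳ i (X (suc i) κ) v i<n)) (\\-leftDividesˡ _ _))))) ⟩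
      a + (μ v + b) + (- μ v + b' + e)   ≈⟨ +-cong
          (trans (+-congˡ (+-comm _ _)) (sym (+-assoc _ _ _))) (+-assoc _ _ _) ⟩
      a + b + μ v + (- μ v + (b' + e))   ≈⟨ +-assoc _ _ _ ⟩
      a + b + (μ v + (- μ v + (b' + e))) ≈⟨ +-congˡ (\\-leftDividesˡ _ _) ⟩
      a + b + (b' + e)                   ≈⟨ interchange _ _ _ _ ⟩
      a + b' + (b + e)
        ≈⟨ trans (ddₗ.T-⊞ i _ _ v) (+-cong (ddₗ.T-⊞ i _ _ v)
             (trans (ddₗ.T-⊞ i _ _ v) (+-congˡ
                 (ddₗ.T-cong i (λ _ u → reflexive (≡.cong κ (bump-comm i (suc i) u))) v)))) ⟨
      dd i (E (suc i ∷ i ∷ L) (2 ℕ.+ j) f) v ∎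
      where
      μ = E L (suc j) f
      κ = E L j f
      a = dd i (E L (2 ℕ.+ j) f) v
      b = dd i (X (suc i) μ) v
      b' = dd i (X i μ) v
      e = dd i (X i (X (suc i) κ)) v

    H-dd-above : ∀ t d (f : Dual n) → H (downFrom (t ℕ.+ (2 ℕ.+ i))) d (dd i f) ≐
      dd i (H (downFrom (t ℕ.+ (2 ℕ.+ i))) d f)
    H-dd-above zero    d       f v = H-dd-suc-suc d f v
    H-dd-above (suc t) zero    f v = refl
    H-dd-above (suc t) (suc d) f v = trans
      (+-cong (H-dd-above t (suc d) f v) (trans (H-dd-above (suc t) d f _) (ddₗ.T-X i off _ v)))
      (sym (ddₗ.T-⊞ i _ _ v))
      where
      off : Off i (t ℕ.+ (2 ℕ.+ i))
      off = ℕₚ.>⇒≢ (ℕₚ.m≤n⇒m≤o+n t (ℕₚ.n≤1+n _)) , ℕₚ.>⇒≢ (ℕₚ.m≤n+m _ t)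

    E-dd-above : ∀ t j (f : Dual n) → E (downFrom (t ℕ.+ (2 ℕ.+ i))) j (dd i f) ≐
      dd i (E (downFrom (t ℕ.+ (2 ℕ.+ i))) j f)
    E-dd-above zero    j       f v = E-dd-suc-suc j f v
    E-dd-above (suc t) zero    f v = refl
    E-dd-above (suc t) (suc j) f v = trans
      (+-cong (E-dd-above t (suc j) f v) (trans (E-dd-above t j f _) (ddₗ.T-X i off _ v)))
      (sym (ddₗ.T-⊞ i _ _ v))
      where
      off : Off i (t ℕ.+ (2 ℕ.+ i))
      off = ℕₚ.>⇒≢ (ℕₚ.m≤n⇒m≤o+n t (ℕₚ.n≤1+n _)) , ℕₚ.>⇒≢ (ℕₚ.m≤n+m _ t)

  -- Residues and Newton's identities

  x+[y-x] : ∀ x y → x + (y - x) ≈ y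
  x+[y-x] x y = trans (+-congˡ (+-comm _ _)) (\\-leftDividesˡ x y)

  -- With y the variable at index p and w free of y, coefT p g (y^q w) = g q w.
  coefT : ℕ → (ℕ → Dual n) → Dual n
  coefT p       g []      = 0#
  coefT zero    g (x ∷ v) = g x (0 ∷ v)
  coefT (suc p) g (x ∷ v) = coefT p (λ q u → g q (x ∷ u)) v

  coefT-X : ∀ p (g : ℕ → Dual n) → X p (coefT p g) ≐ coefT p (λ q → g (suc q))
  coefT-X p       g []      = refl
  coefT-X zero    g (x ∷ v) = refl
  coefT-X (suc p) g (x ∷ v) = coefT-X p _ v

  coefT-linear : ∀ p → Linear {n} (_≢ p) (coefT p)
  coefT-linear p = record
    { T-cong = ct-cong p
    ; T-⊞    = ct-⊞ p
    ; T-X    = ct-X p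
    }
    where
    ct-cong : ∀ {n} p {g h : ℕ → Dual n} → (∀ i → g i ≐ h i) → coefT p g ≐ coefT p h
    ct-cong p       e []      = refl
    ct-cong zero    e (x ∷ v) = e x _
    ct-cong (suc p) e (x ∷ v) = ct-cong p (λ q u → e q (x ∷ u)) v
    ct-⊞ : ∀ {n} p (g h : ℕ → Dual n) → coefT p (λ i → g i ⊞ h i) ≐ coefT p g ⊞ coefT p h
    ct-⊞ p       g h []      = sym (+-identityʳ 0#)
    ct-⊞ zero    g h (x ∷ v) = refl
    ct-⊞ (suc p) g h (x ∷ v) = ct-⊞ p _ _ v
    ct-X : ∀ {n} p {x} → x ≢ p → (g : ℕ → Dual n) → X x (coefT p g) ≐ coefT p (λ i → X x (g i))
    ct-X p       x≢p g []      = refl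
    ct-X zero    {zero}  x≢p g (y ∷ v) = ⊥-elim (x≢p ≡.refl)
    ct-X zero    {suc x} x≢p g (y ∷ v) = refl
    ct-X (suc p) {zero}  x≢p g (y ∷ v) = refl
    ct-X (suc p) {suc x} x≢p g (y ∷ v) = ct-X p (λ e → x≢p (≡.cong suc e)) _ v

  module coefTₗ {n} p = Linear (coefT-linear {n} p)

  -- conv L d g = Σ_{j ≤ d} h_{d-j}(L) · g j
  conv : List ℕ → ℕ → (ℕ → Dual n) → Dual n
  conv L zero    g = g 0
  conv L (suc d) g = H L (suc d) (g 0) ⊞ conv L d (λ q → g (suc q))

  conv-cong : ∀ L d {g h : ℕ → Dual n} → (∀ q → g q ≐ h q) → conv L d g ≐ conv L d h
  conv-cong L zero    e v = e 0 v
  conv-cong L (suc d) e v = +-cong (H-cong L (suc d) (e 0) v) (conv-cong L d (λ q → e (suc q)) v)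

  -- With y the variable of index p, h_d(L, y) is the sum of h_{d-q}(L) y^q, and multiplication by
  -- y^q shifts the index of g by q.
  H-coefT : ∀ p d (g : ℕ → Dual n) →
    H (downFrom (suc p)) d (coefT p g) ≐ coefT p (λ s → conv (downFrom p) d (λ q → g (s ℕ.+ q)))
  H-coefT p zero    g v = coefTₗ.T-cong p (λ s u →
      reflexive (≡.cong (λ q → g q u) (≡.sym (ℕₚ.+-identityʳ s)))) v
  H-coefT p (suc d) g v = begin
    H L (suc d) (coefT p g) v + H (p ∷ L) d (coefT p g) (bump p v)
      ≈⟨ +-cong (coefTₗ.H-T p off (suc d) g v)
          (trans (sym (Xₗ.H-T p (everywhere (p ∷ L)) d (λ _ → coefT p g) v))
          (trans (H-cong (p ∷ L) d (coefT-X p g) v) (H-coefT p d _ v))) ⟩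
    coefT p (λ s → H L (suc d) (g s)) v + coefT p (λ s → conv L d (λ q → g (suc (s ℕ.+ q)))) v
      ≈⟨ coefTₗ.T-⊞ p _ _ v ⟨
    coefT p (λ s → H L (suc d) (g s) ⊞ conv L d (λ q → g (suc (s ℕ.+ q)))) v
      ≈⟨ coefTₗ.T-cong p (λ s u → +-cong
           (reflexive (≡.cong (λ q → H L (suc d) (g q) u) (≡.sym (ℕₚ.+-identityʳ s))))
           (conv-cong L d (λ q w → reflexive (≡.cong (λ r → g r w) (≡.sym (ℕₚ.+-suc s q)))) u)) v ⟩
    coefT p (λ s → conv L (suc d) (λ q → g (s ℕ.+ q))) v ∎
    where
    L = downFrom p
    off : All (_≢ p) L
    off = All.map (λ o → proj₁ o) (downFrom-off ℕₚ.≤-refl)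

  conv-∷ : ∀ x L d (g : ℕ → Dual n) →
    conv (x ∷ L) (suc d) g ≐ conv L (suc d) g ⊞ X x (conv (x ∷ L) d g)
  conv-∷ x L zero    g v = trans (+-assoc _ _ _)
      (trans (+-congˡ (+-comm _ _)) (sym (+-assoc _ _ _)))
  conv-∷ x L (suc d) g v = trans (+-congˡ (conv-∷ x L d _ v)) (interchange _ _ _ _)

  H-⊞ : ∀ L d (f g : Dual n) → H L d (f ⊞ g) ≐ H L d f ⊞ H L d g
  H-⊞ L       zero    f g v = refl
  H-⊞ []      (suc d) f g v = sym (+-identityʳ 0#)
  H-⊞ (x ∷ L) (suc d) f g v = trans (+-cong (H-⊞ L (suc d) f g v) (H-⊞ (x ∷ L) d f g _))
      (interchange _ _ _ _)

  H-X : ∀ x L d (f : Dual n) → X x (H L d f) ≐ H L d (X x f)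
  H-X x L d f v = sym (Xₗ.H-T x (everywhere L) d (λ _ → f) v)

  conv-⊞ : ∀ L d (g h : ℕ → Dual n) → conv L d (λ q → g q ⊞ h q) ≐ conv L d g ⊞ conv L d h
  conv-⊞ L zero    g h v = refl
  conv-⊞ L (suc d) g h v = trans (+-cong (H-⊞ L (suc d) _ _ v) (conv-⊞ L d _ _ v))
      (interchange _ _ _ _)

  conv-X : ∀ x L d (g : ℕ → Dual n) → X x (conv L d g) ≐ conv L d (λ q → X x (g q))
  conv-X x L zero    g v = refl
  conv-X x L (suc d) g v = +-cong (H-X x L (suc d) _ v) (conv-X x L d _ v)

  H-vanishes : ∀ L d {f : Dual n} → Vanishes f → Vanishes (H L d f)
  H-vanishes L       zero    z v = z v
  H-vanishes []      (suc d) z v = refl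
  H-vanishes (x ∷ L) (suc d) z v = 0+0 (H-vanishes L (suc d) z v) (H-vanishes (x ∷ L) d z _)

  conv-vanishes : ∀ L d {g : ℕ → Dual n} → (∀ q → Vanishes (g q)) → Vanishes (conv L d g)
  conv-vanishes L zero    z v = z 0 v
  conv-vanishes L (suc d) z v = 0+0 (H-vanishes L (suc d) (z 0) v)
      (conv-vanishes L d (λ q → z (suc q)) v)

  -- In generating functions, adjoining x multiplies the complete homogeneous series by 1/(1 - x t)
  -- and the signed elementary series by 1 - x t. The product is unchanged, so the sum reduces to
  -- that of the empty list, where no positive degree occurs.
  newton : ∀ L d (f : Dual n) → Vanishes (conv L (suc d) (λ q → Es L q f))
  newton [] d f v = 0+0 refl (conv-vanishes [] d (λ q u → refl) v)
  newton (x ∷ L) d f v = trans (+-cancelʳ (conv M d a (bump x v)) _ _ (begin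
    conv M (suc d) b v + conv M d a (bump x v)
      ≈⟨ +-assoc _ _ _ ⟩
    H M (suc d) f v + (conv M d (λ q → b (suc q)) v + conv M d a (bump x v))
      ≈⟨ +-congˡ (trans (+-congˡ (conv-X x M d a v)) (sym (conv-⊞ M d _ _ v))) ⟩
    H M (suc d) f v + conv M d (λ q → b (suc q) ⊞ X x (a q)) v
      ≈⟨ +-congˡ (conv-cong M d (λ q u → trans (+-comm _ _) (x+[y-x] _ _)) v) ⟩
    conv M (suc d) a v
      ≈⟨ conv-∷ x L d a v ⟩
    conv L (suc d) a v + conv M d a (bump x v) ∎)) (newton L d f v)
    where
    M = x ∷ L
    a b : ℕ → Dual _
    a q = Es L q f
    b q = Es M q f

  -- Extraction of the coefficient of y^b modulo h_D(L, y), for b < D, up to terms of lower order: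
  -- y^q ↦ (-1)^{q-b} e_{q-b}(L).
  signedE : List ℕ → ℕ → Dual n → ℕ → Dual n
  signedE L zero    f q       = Es L q f
  signedE L (suc b) f zero    = λ _ → 0#
  signedE L (suc b) f (suc q) = signedE L b f q

  signedE-vanishes : ∀ L b (f : Dual n) (T : Dual n → Dual n) →
    (∀ {g} → Vanishes g → Vanishes (T g)) → (∀ q → Vanishes (T (Es L q f))) → ∀ q →
        Vanishes (T (signedE L b f q))
  signedE-vanishes L zero    f T z e q       = e q
  signedE-vanishes L (suc b) f T z e zero    = z (λ _ → refl)
  signedE-vanishes L (suc b) f T z e (suc q) = signedE-vanishes L b f T z e q

  E-vanishes : ∀ L j {f : Dual n} → Vanishes f → Vanishes (E L j f)
  E-vanishes L       zero    z v = z v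
  E-vanishes []      (suc j) z v = refl
  E-vanishes (x ∷ L) (suc j) z v = 0+0 (E-vanishes L (suc j) z v) (E-vanishes L j z _)

  H-Es-vanishes : ∀ L d M {f : Dual n} → Vanishes (H L d f) → ∀ q → Vanishes (H L d (Es M q f))
  H-Es-vanishes L d M {f} z q v = trans (Esₗ.H-T M q (everywhere L) d (λ _ → f) v)
      (Esₗ.T-vanishes M q (λ _ → z) v)

  E-Es-vanishes : ∀ L j M {f : Dual n} → Vanishes (E L j f) → ∀ q → Vanishes (E L j (Es M q f))
  E-Es-vanishes L j M {f} z q v = trans (Esₗ.E-T M q (everywhere L) j (λ _ → f) v)
      (Esₗ.T-vanishes M q (λ _ → z) v)

  -- The part of Newton's sum with indices at least u vanishes, since the other terms
  -- involve h_e(L) with e > d only.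
  newton-tail : ∀ L u d {f : Dual n} → (∀ e → d < e → Vanishes (H L e f)) → 0 < u ℕ.+ d →
    Vanishes (conv L d (λ q → Es L (u ℕ.+ q) f))
  newton-tail L zero    (suc d) {f} z _ = newton L d f
  newton-tail L (suc u) d       {f} z _ v = begin
    conv L d (λ q → Es L (suc (u ℕ.+ q)) f) v
      ≈⟨ conv-cong L d (λ q w → reflexive (≡.cong (λ r → Es L r f w) (≡.sym (ℕₚ.+-suc u q)))) v ⟩
    conv L d (λ q → Es L (u ℕ.+ suc q) f) v
      ≈⟨ +-identityˡ _ ⟨
    0# + conv L d (λ q → Es L (u ℕ.+ suc q) f) v
      ≈⟨ +-congʳ (H-Es-vanishes L (suc d) L (z (suc d) (ℕₚ.n<1+n d)) (u ℕ.+ 0) v) ⟨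
    conv L (suc d) (λ q → Es L (u ℕ.+ q) f) v
      ≈⟨ newton-tail L u (suc d) (λ e p → z e (ℕₚ.<⇒≤ p))
          (≡.subst (0 <_) (≡.sym (ℕₚ.+-suc u d)) (s≤s z≤n)) v ⟩
    0# ∎

  -- For s < b the first b - s terms are 0 and the rest is the full Newton sum of degree d - (b -
  -- s), which is positive because b < d. For s ≥ b the sum is a tail of Newton's sum, starting at s
  -- - b.
  conv-signedE : ∀ L b d {f : Dual n} → b < d → (∀ e → d < e → Vanishes (H L e f)) →
    ∀ s → Vanishes (conv L d (λ q → signedE L b f (s ℕ.+ q)))
  conv-signedE L zero    d       b<d z s = newton-tail L s d z (ℕₚ.<-≤-trans b<d (ℕₚ.m≤n+m d s))
  conv-signedE L (suc b) d       b<d z (suc s) = conv-signedE L b d (ℕₚ.<⇒≤ b<d) z s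
  conv-signedE L (suc b) (suc d) {f} (s≤s b<d) z zero v = low (suc b) (suc d) (s≤s b<d)
    where
    low : ∀ b d → b < d → conv L d (signedE L b f) v ≈ 0#
    low zero    (suc d) _         = newton L d f v
    low (suc b) (suc d) (s≤s b<d) = 0+0 (H-vanishes L (suc d) (λ _ → refl) v) (low b d b<d)

  -- Functionals dual to the nonskip monomials

  private variable
    l b c′ : ℕ

  chain : ℕ → ℕ → Dual n → Dual n
  chain i zero    f = f
  chain i (suc s) f = dd i (chain (suc i) s f)

  module _ (k : ℕ) where

    -- f kills the ideal of the first l + c variables generated by these h_d(x_1..x_i) and e_j.
    -- For l = n and c = 0 it contains J_{n,k}; it is contained in the ideal for (l - 1, c + 1),
    -- which is stable under divided differences in x_l, …, x_{l+c} (kills-dd).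
    record Kills (l c : ℕ) (f : Dual n) : Set ℓ where
      field
        killsH : ∀ i d → i ≤ l ℕ.+ c → k ≤ suc d ℕ.+ (i ∸ suc l) →
            Vanishes (H (downFrom i) (suc d) f)
        killsE : ∀ j → l ℕ.+ c < j ℕ.+ k → Vanishes (E (downFrom (l ℕ.+ c)) j f)
    open Kills

    -- The number of variables l + c stays the same while the subtracted `suc l` grows, so fewer
    -- complete homogeneous polynomials have to be killed.
    kills-suc : ∀ {f : Dual n} → Kills l (suc c′) f → Kills (suc l) c′ f
    kills-suc {l = l} {c′ = c′} {f} K = record
      { killsH = λ i d p q → killsH K i d (ℕₚ.≤-trans p (ℕₚ.≤-reflexive (≡.sym e)))
          (ℕₚ.≤-trans q (ℕₚ.+-monoʳ-≤ (suc d) (ℕₚ.∸-monoʳ-≤ i (ℕₚ.n≤1+n (suc l)))))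
      ; killsE = λ j p → ≡.subst (λ N → Vanishes (E (downFrom N) j f)) e
          (killsE K j (ℕₚ.≤-<-trans (ℕₚ.≤-reflexive e) p))
      }
      where
      e : l ℕ.+ suc c′ ≡ suc l ℕ.+ c′
      e = ℕₚ.+-suc l c′

    -- Only h_d in the variables of index at most i fails to commute with ∂_i. The Leibniz rule then
    -- produces degree d - 1 in one more variable, which is why the degree bound in `Kills` falls by
    -- one for each variable beyond l + 1.
    kills-dd : ∀ {i} {f : Dual n} → l ≤ i → suc i < l ℕ.+ c′ → l ℕ.+ c′ ≤ n → 2 ℕ.+ i ≤ l ℕ.+ k →
      Kills l c′ f → Kills l c′ (dd i f)
    kills-dd {n} {l} {c′} {i} {f} l≤i i<N N≤n i≤k K = record
      { killsH = hs
      ; killsE = es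
      }
      where
      i<n : suc i < n
      i<n = ℕₚ.<-≤-trans i<N N≤n
      dd-vanishes : ∀ {g : Dual n} → Vanishes g → Vanishes (dd i g)
      dd-vanishes z = ddₗ.T-vanishes i (λ _ → z)
      es : ∀ j → l ℕ.+ c′ < j ℕ.+ k → Vanishes (E (downFrom (l ℕ.+ c′)) j (dd i f))
      es j p v = trans
        (≡.subst (λ N → E (downFrom N) j (dd i f) ≐ dd i (E (downFrom N) j f)) (ℕₚ.m∸n+n≡m i<N)
          (E-dd-above i i<n (l ℕ.+ c′ ∸ (2 ℕ.+ i)) j f) v)
        (dd-vanishes (killsE K j p) v)
      hs : ∀ i′ d → i′ ≤ l ℕ.+ c′ → k ≤ suc d ℕ.+ (i′ ∸ suc l) →
          Vanishes (H (downFrom i′) (suc d) (dd i f))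
      hs i′ d p q with ℕₚ.<-cmp i′ (suc i)
      ... | tri< (s≤s i′≤i) _ _ = λ v → trans (ddₗ.H-T i (downFrom-off i′≤i) (suc d) (λ _ → f) v)
                                          (dd-vanishes (killsH K i′ d p q) v)
      ... | tri> _ _ i<i′ = λ v → trans
              (≡.subst (λ N → H (downFrom N) (suc d) (dd i f) ≐ dd i (H (downFrom N) (suc d) f))
                  (ℕₚ.m∸n+n≡m i<i′)
                (H-dd-above i i<n (i′ ∸ (2 ℕ.+ i)) (suc d) f) v)
              (dd-vanishes (killsH K i′ d p q) v)
      -- From degree 1 the Leibniz rule would produce degree 0, the constant 1, which f need not
      -- kill. The bound 2 + i ≤ l + k excludes this case.
      hs .(suc i) zero p q | tri≈ _ ≡.refl _ = ⊥-elim (ℕₚ.<⇒≱ i≤k (ℕₚ.≤-trans (ℕₚ.+-monoʳ-≤ l q)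
        (ℕₚ.≤-reflexive (≡.trans (ℕₚ.+-suc l (i ∸ l)) (≡.cong suc (ℕₚ.m+[n∸m]≡n l≤i))))))
      hs .(suc i) (suc d) p q | tri≈ _ ≡.refl _ = λ v → trans (H-dd-suc i i<n (suc d) f v)
          (0+0 (dd-vanishes other v) (both v))
        where
        L = downFrom i
        both : Vanishes (H (downFrom (2 ℕ.+ i)) (suc d) f)
        both = killsH K (2 ℕ.+ i) d i<N (≡.subst (k ≤_)
          (≡.trans (≡.sym (ℕₚ.+-suc (suc d) (i ∸ l)))
              (≡.cong (suc d ℕ.+_) (≡.sym (ℕₚ.+-∸-assoc 1 l≤i)))) q)
        -- For y, z of indices i, i + 1: h_{d+2}(L, z) = h_{d+2}(L, y, z) - y h_{d+1}(L, y, z), and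
        -- f kills both terms on the right.
        other : Vanishes (H (suc i ∷ L) (suc (suc d)) f)
        other v = begin
          x       ≈⟨ +-identityʳ x ⟨
          x + 0#  ≈⟨ +-congˡ (both (bump i v)) ⟨
          x + H (suc i ∷ i ∷ L) (suc d) f (bump i v)  ≈⟨ +-congˡ (H-swap (suc i) i L (suc d) f _) ⟩
          H (i ∷ suc i ∷ L) (2 ℕ.+ d) f v             ≈⟨ H-swap i (suc i) L (2 ℕ.+ d) f v ⟩
          H (suc i ∷ i ∷ L) (2 ℕ.+ d) f v             ≈⟨ 0+0 (killsH K (suc i) (suc d) p q v)
              (both _) ⟩
          0#      ∎
          where x = H (suc i ∷ L) (suc (suc d)) f v

    -- Polynomials free of the new variable y act through f. Both parts of e_j(L, y) = e_j(L) + y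
    -- e_{j-1}(L) are of killed degree. For h_d(L, y) with k ≤ d + c, the hypothesis b + c < k gives
    -- b < d, and f kills h_e(L) for e > d; hence one functional serves all these d.
    kills-coefT : ∀ {f : Dual n} → b ℕ.+ c′ < k → Kills l c′ f →
      Kills l (suc c′) (coefT (l ℕ.+ c′) (signedE (downFrom (l ℕ.+ c′)) b f))
    kills-coefT {n} {b} {c′} {l} {f} b+c<k K = record
      { killsH = hs
      ; killsE = ≡.subst (λ N → ∀ j → N < j ℕ.+ k → Vanishes (E (downFrom N) j g)) (≡.sym e) es
      }
      where
      p = l ℕ.+ c′
      L = downFrom p
      g : Dual n
      g = coefT p (signedE L b f)
      e : l ℕ.+ suc c′ ≡ suc p
      e = ℕₚ.+-suc l c′
      Eg : ∀ j → p < j ℕ.+ k → Vanishes (E L j g)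
      Eg j q v = trans
        (coefTₗ.E-T p (All.map proj₁ (downFrom-off ℕₚ.≤-refl)) j _ v)
        (coefTₗ.T-vanishes p (signedE-vanishes L b f (E L j) (E-vanishes L j)
            (E-Es-vanishes L j L (killsE K j q))) v)
      es : ∀ j → suc p < j ℕ.+ k → Vanishes (E (downFrom (suc p)) j g)
      es zero    q v = Eg zero (ℕₚ.<⇒≤ q) v
      es (suc j) q v = 0+0 (Eg (suc j) (ℕₚ.<⇒≤ q) v) (Eg j (ℕₚ.≤-pred q) _)
      hs : ∀ i d → i ≤ l ℕ.+ suc c′ → k ≤ suc d ℕ.+ (i ∸ suc l) →
          Vanishes (H (downFrom i) (suc d) g)
      hs i d i≤N q with i ℕ.≤? p
      ... | yes i≤p = λ v → trans
              (coefTₗ.H-T p (All.map proj₁ (downFrom-off i≤p)) (suc d) _ v)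
              (coefTₗ.T-vanishes p (signedE-vanishes L b f (H (downFrom i) (suc d))
                  (H-vanishes (downFrom i) (suc d))
                (H-Es-vanishes (downFrom i) (suc d) L (killsH K i d i≤p q))) v)
      ... | no i≰p with ℕₚ.≤-antisym (≡.subst (i ≤_) e i≤N) (ℕₚ.≰⇒> i≰p)
      ...   | ≡.refl = λ v → trans (H-coefT p (suc d) _ v)
              (coefTₗ.T-vanishes p (conv-signedE L b (suc d) b<d higher) v)
        where
        k≤d+c : k ≤ suc d ℕ.+ c′
        k≤d+c = ≡.subst (λ x → k ≤ suc d ℕ.+ x) (ℕₚ.m+n∸m≡n l c′) q
        b<d : b < suc d
        b<d = ℕₚ.+-cancelʳ-< c′ b (suc d) (ℕₚ.<-≤-trans b+c<k k≤d+c)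
        higher : ∀ e → suc d < e → Vanishes (H L e f)
        higher (suc e) d<e = killsH K p e ℕₚ.≤-refl (≤-degree-shift l c′ k≤d+c d<e)

    kills-chain : ∀ s {i} {f : Dual n} → l ≤ i → i ℕ.+ s < l ℕ.+ c′ → l ℕ.+ c′ ≤ n →
        i ℕ.+ s < l ℕ.+ k →
      Kills l c′ f → Kills l c′ (chain i s f)
    kills-chain zero    _ _ _ _ K = K
    kills-chain {l = l} {c′} (suc s) {i} l≤i i<N N≤n i<k K = kills-dd l≤i
      (ℕₚ.≤-<-trans i+1≤ i<N) N≤n (ℕₚ.≤-<-trans i+1≤ i<k)
      (kills-chain s (ℕₚ.m≤n⇒m≤1+n l≤i) (≡.subst (_< l ℕ.+ c′) (ℕₚ.+-suc i s) i<N) N≤n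
        (≡.subst (_< l ℕ.+ k) (ℕₚ.+-suc i s) i<k) K)
      where
      i+1≤ : suc i ≤ i ℕ.+ suc s
      i+1≤ = ≡.subst (suc i ≤_) (≡.sym (ℕₚ.+-suc i s)) (s≤s (ℕₚ.m≤m+n i s))

  -- For w in the first p variables and y the next one, f (y^x w) is 0 for x < b and g w for x = b.
  LeadsAt : ℕ → ℕ → Dual n → Dual n → Set ℓ
  LeadsAt p b f g = ∀ v →
    (∀ x → x < b → f (put p x (trunc p v)) ≈ 0#) × f (put p b (trunc p v)) ≈ g (trunc p v)

  D-vanishes : ∀ {f} p → (∀ s t → t < p → f s t ≈ 0#) → D f p 0 ≈ 0#
  D-vanishes zero    z = refl
  D-vanishes (suc p) z = 0+0 (z p 0 (s≤s z≤n)) (D-vanishes p (λ s t q → z s (suc t) (s≤s q)))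

  D-lead : ∀ {f} p → (∀ s t → t < p → f s t ≈ 0#) → D f (suc p) 0 ≈ f 0 p
  D-lead zero    z = +-identityʳ _
  D-lead (suc p) z = trans (+-cong (z (suc p) 0 (s≤s z≤n))
      (D-lead p (λ s t q → z s (suc t) (s≤s q)))) (+-identityˡ _)

  dd-put : ∀ p x (f : Dual n) v → suc p < n →
    dd p f (put p x (trunc p v)) ≡ D (λ s t → f (put (suc p) t (trunc (suc p) (put p s v)))) x 0
  dd-put zero    x f (y ∷ [])    (s≤s ())
  dd-put zero    x f (y ∷ z ∷ v) _       = ≡.refl
  dd-put (suc p) x f (y ∷ v)     (s≤s q) = dd-put p x (λ u → f (y ∷ u)) v q

  -- For y, z of indices p, p + 1, ∂(y^x) is the sum of y^s z^t over s + t = x - 1. While x ≤ b all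
  -- t are below b and f vanishes; at x = b + 1 only z^b remains.
  leadsAt-dd : ∀ {p} (f g : Dual n) → suc p < n → LeadsAt (suc p) b f g →
      LeadsAt p (suc b) (dd p f) g
  leadsAt-dd {b = b} {p} f g q le v =
    (λ x x<b → trans (reflexive (dd-put p x f v q))
       (D-vanishes x (λ s t t<x → proj₁ (le (put p s v)) t (ℕₚ.<-≤-trans t<x (ℕₚ.≤-pred x<b))))) ,
    (begin
      dd p f (put p (suc b) (trunc p v))                    ≡⟨ dd-put p (suc b) f v q ⟩
      D (λ s t → f (put (suc p) t (trunc (suc p) (put p s v)))) (suc b) 0
        ≈⟨ D-lead b (λ s → proj₁ (le (put p s v))) ⟩
      f (put (suc p) b (trunc (suc p) (put p 0 v)))         ≈⟨ proj₂ (le (put p 0 v)) ⟩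
      g (trunc (suc p) (put p 0 v))                         ≡⟨ ≡.cong g (trunc-suc-put-zero p v) ⟩
      g (trunc p v)                                         ∎)

  leadsAt-chain : ∀ s {p} (f g : Dual n) → p ℕ.+ s < n →
    LeadsAt (p ℕ.+ s) b f g → LeadsAt p (s ℕ.+ b) (chain p s f) g
  leadsAt-chain         zero    {p} f g q le = ≡.subst (λ r → LeadsAt r _ f g) (ℕₚ.+-identityʳ p) le
  leadsAt-chain {n} {b} (suc s) {p} f g q le =
      leadsAt-dd (chain (suc p) s f) g (ℕₚ.≤-<-trans (s≤s (ℕₚ.m≤m+n p s)) q′)
    (leadsAt-chain s f g q′ (≡.subst (λ r → LeadsAt r b f g) (ℕₚ.+-suc p s) le))
    where
    q′ : suc (p ℕ.+ s) < n
    q′ = ≡.subst (_< n) (ℕₚ.+-suc p s) q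

  leadsAt-zero : ∀ p (f : Dual n) → LeadsAt p 0 f f
  leadsAt-zero p f v = (λ _ ()) , reflexive (≡.cong f (put-zero-trunc p v))

  coefT-put : ∀ p x (g : ℕ → Dual n) v → p < n → coefT p g (put p x (trunc p v)) ≡ g x (trunc p v)
  coefT-put zero    x g (y ∷ v) _       = ≡.refl
  coefT-put (suc p) x g (y ∷ v) (s≤s q) = coefT-put p x (λ q u → g q (y ∷ u)) v q

  leadsAt-coefT : ∀ p L b (f : Dual n) → p < n → LeadsAt p b (coefT p (signedE L b f)) f
  leadsAt-coefT p L b f q v =
    (λ x x<b → trans (reflexive (coefT-put p x _ v q)) (below b x x<b)) ,
    reflexive (≡.trans (coefT-put p b _ v q) (equal b))
    where
    below : ∀ b x → x < b → signedE L b f x (trunc p v) ≈ 0#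
    below (suc b) zero    _       = refl
    below (suc b) (suc x) (s≤s r) = below b x r
    equal : ∀ b → signedE L b f b (trunc p v) ≡ f (trunc p v)
    equal zero    = ≡.refl
    equal (suc b) = equal b

  -- Evaluation at 0 and the construction of the functional.

  ε₀ : Dual n
  ε₀ []          = 1#
  ε₀ (zero ∷ v)  = ε₀ v
  ε₀ (suc x ∷ v) = 0#

  ε₀-0s : ∀ n → ε₀ (0s {n}) ≡ 1#
  ε₀-0s zero    = ≡.refl
  ε₀-0s (suc n) = ε₀-0s n

  ε₀-X : ∀ {i} → i < n → Vanishes (X {n} i ε₀)
  ε₀-X {i = zero}  _       (x ∷ v)     = refl
  ε₀-X {i = suc i} (s≤s p) (zero ∷ v)  = ε₀-X p v
  ε₀-X {i = suc i} (s≤s p) (suc x ∷ v) = refl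

  ε₀-H : ∀ {i} → i ≤ n → ∀ d → Vanishes (H (downFrom i) (suc d) (ε₀ {n}))
  ε₀-H {i = zero}  _ d v = refl
  ε₀-H {i = suc i} p d v = 0+0 (ε₀-H (ℕₚ.<⇒≤ p) d v)
      (trans (H-X i (downFrom (suc i)) d ε₀ v) (H-vanishes (downFrom (suc i)) d (ε₀-X p) v))

  E-X : ∀ x L j (f : Dual n) → X x (E L j f) ≐ E L j (X x f)
  E-X x L j f v = sym (Xₗ.E-T x (everywhere L) j (λ _ → f) v)

  ε₀-E : ∀ {i} → i ≤ n → ∀ j → Vanishes (E (downFrom i) (suc j) (ε₀ {n}))
  ε₀-E {i = zero}  _ j v = refl
  ε₀-E {i = suc i} p j v = 0+0 (ε₀-E (ℕₚ.<⇒≤ p) j v)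
      (trans (E-X i (downFrom i) j ε₀ v) (E-vanishes (downFrom i) j (ε₀-X p) v))

  module _ (k : ℕ) (m : Monomial n) (small : ∀ l → l < n → at l m < k)
      (stairs≥ : k ≤ stairs m) where

    LeadsTo : ℕ → Dual n → Set ℓ
    LeadsTo l f = (∀ v → trunc l v ≺ trunc l m → f (trunc l v) ≈ 0#) × f (trunc l m) ≈ 1#

    leadsTo-suc : ∀ (f g : Dual n) → l < n → LeadsAt l (at l m) f g → LeadsTo l g →
        LeadsTo (suc l) f
    leadsTo-suc {l = l} f g l<n le (z , o) = below ,
      trans (reflexive (≡.cong f (trunc-suc l m))) (trans (proj₂ (le m)) o)
      where
      below : ∀ v → trunc (suc l) v ≺ trunc (suc l) m → f (trunc (suc l) v) ≈ 0#
      below v p rewrite trunc-suc l v | trunc-suc l m with put-≺ v m l<n p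
      ... | inj₁ x<a         = proj₁ (le v) _ x<a
      ... | inj₂ (x≡a , v≺m) rewrite x≡a = trans (proj₂ (le v)) (z v v≺m)

    -- The counter `stairsFrom l m` is the number of variables beyond the l-th that the ideal
    -- involves: at least k of them for l = 0, and none for l = n.
    functional : ∀ l → l ≤ n → Σ (Dual n) λ f → Kills k l (stairsFrom l m) f × LeadsTo l f
    functional zero _ = ε₀ ,
      record { killsH = λ i d p _ → ε₀-H (ℕₚ.≤-trans p (stairs≤ m)) d
             -- Killing e_0 = 1 would be demanded only if the counter ended below k.
             ; killsE = λ { zero    p → ⊥-elim (ℕₚ.<⇒≱ p stairs≥)
                          ; (suc j) p → ε₀-E (stairs≤ m) j } } ,
      (λ v p → ⊥-elim (≺-irrefl p)) , reflexive (ε₀-0s n)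
    functional (suc l) l<n = step (functional l (ℕₚ.<⇒≤ l<n))
      where
      a = at l m
      c₁ = stairsFrom (suc l) m
      N≤n : l ℕ.+ suc c₁ ≤ n
      N≤n = ≡.subst (_≤ n) (≡.sym (ℕₚ.+-suc l c₁)) (stairsFrom≤ (suc l) m l<n)
      step : (Σ (Dual n) λ f → Kills k l (stairsFrom l m) f × LeadsTo l f) →
        Σ (Dual n) λ f → Kills k (suc l) c₁ f × LeadsTo (suc l) f
      step (f , K , le) rewrite stairsFrom-climb l m l<n with a ℕ.≤? c₁
      -- The a divided differences start from exponent 0 at index l + a, which is in range because a
      -- ≤ c₁ and f involves l + 1 + c₁ variables.
      ... | yes a≤c = chain l a f ,
              kills-suc k (kills-chain k a ℕₚ.≤-refl (ℕₚ.+-monoʳ-< l (s≤s a≤c)) N≤n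
                  (ℕₚ.+-monoʳ-< l (small l l<n)) K) ,
              leadsTo-suc (chain l a f) f l<n (≡.subst (λ b → LeadsAt l b (chain l a f) f)
                  (ℕₚ.+-identityʳ a)
                (leadsAt-chain a f f (ℕₚ.<-≤-trans (ℕₚ.+-monoʳ-< l (s≤s a≤c)) N≤n)
                    (leadsAt-zero (l ℕ.+ a) f))) le
      -- The adjoined variable has index l + c₁ and leading exponent a - c₁; moving it to index l
      -- adds the missing c₁.
      ... | no a≰c = chain l c₁ g ,
              kills-suc k (kills-chain k c₁ ℕₚ.≤-refl (ℕₚ.+-monoʳ-< l ℕₚ.≤-refl) N≤n
                  (ℕₚ.+-monoʳ-< l (ℕₚ.<-trans c<a (small l l<n)))
                (kills-coefT k (≡.subst (_< k) (≡.sym (ℕₚ.m∸n+n≡m (ℕₚ.<⇒≤ c<a)))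
                    (small l l<n)) K)) ,
              leadsTo-suc (chain l c₁ g) f l<n
                  (≡.subst (λ b → LeadsAt l b (chain l c₁ g) f) (ℕₚ.m+[n∸m]≡n (ℕₚ.<⇒≤ c<a))
                (leadsAt-chain c₁ g f p<n (leadsAt-coefT p (downFrom p) (a ∸ c₁) f p<n))) le
        where
        c<a : c₁ < a
        c<a = ℕₚ.≰⇒> a≰c
        p = l ℕ.+ c₁
        p<n : p < n
        p<n = ℕₚ.<-≤-trans (ℕₚ.+-monoʳ-< l ℕₚ.≤-refl) N≤n
        g : Dual n
        g = coefT p (signedE (downFrom p) (a ∸ c₁) f)

  -- Pairing functionals with polynomials

  open Poly F

  ev : Dual n → Pol n → Carrier
  ev f []            = 0#
  ev f ((a , v) ∷ p) = a * f v + ev f p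

  ev-++ : ∀ (f : Dual n) p q → ev f (p ++ q) ≈ ev f p + ev f q
  ev-++ f []            q = sym (+-identityˡ _)
  ev-++ f ((a , v) ∷ p) q = trans (+-congˡ (ev-++ f p q)) (sym (+-assoc _ _ _))

  ev-cong : ∀ {f g : Dual n} → f ≐ g → ∀ p → ev f p ≈ ev g p
  ev-cong e []            = refl
  ev-cong e ((a , v) ∷ p) = +-cong (*-congˡ (e v)) (ev-cong e p)

  ev-⊞ : ∀ (f g : Dual n) p → ev (f ⊞ g) p ≈ ev f p + ev g p
  ev-⊞ f g []            = sym (+-identityʳ 0#)
  ev-⊞ f g ((a , v) ∷ p) = trans (+-cong (distribˡ a _ _) (ev-⊞ f g p)) (interchange _ _ _ _)

  ev-vanishing : ∀ {f : Dual n} → Vanishes f → ∀ p → ev f p ≈ 0#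
  ev-vanishing z []            = refl
  ev-vanishing z ((a , v) ∷ p) = 0+0 (trans (*-congˡ (z v)) (zeroʳ a)) (ev-vanishing z p)

  infixl 7 _⊛_
  -- The transpose of multiplication by q.
  _⊛_ : Dual n → Pol n → Dual n
  (f ⊛ q) v = ev (λ w → f (v ⊕ w)) q

  ev-*P : ∀ (f : Dual n) p q → ev f (p *P q) ≈ ev (f ⊛ q) p
  ev-*P f []            q = refl
  ev-*P f ((a , v) ∷ p) q = trans (ev-++ f (map _ q) _)
      (+-cong (scale (λ b w → ≡.refl) q) (ev-*P f p q))
    where
    scale : ∀ {g} → (∀ b w → g (b , w) ≡ (a * b , v ⊕ w)) → ∀ q →
        ev f (map g q) ≈ a * ev (λ w → f (v ⊕ w)) q
    scale e []            = sym (zeroʳ a)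
    scale e ((b , w) ∷ q) rewrite e b w = trans (+-cong (*-assoc a b _) (scale e q))
        (sym (distribˡ a _ _))

  ev-combination : ∀ (f : Dual n) gs {gens} → All (λ g → Vanishes (f ⊛ g)) gens →
      ev f (sumP (zipWith _*P_ gs gens)) ≈ 0#
  ev-combination f []       _        = refl
  ev-combination f (_ ∷ gs) []       = refl
  ev-combination f (p ∷ gs) {g ∷ gens} (z ∷ zs) = trans (ev-++ f (p *P g) _)
    (0+0 (trans (ev-*P f p g) (ev-vanishing z p)) (ev-combination f gs zs))

  ev-neg : (p : Pol n) → Σ (Pol n) λ q → ∀ f → ev f q ≈ - ev f p
  ev-neg []            = [] , λ f → sym -0#≈0#
  ev-neg ((a , v) ∷ p) with ev-neg p
  ... | q , e = (- a , v) ∷ q , λ f → trans (+-cong (sym (-‿distribˡ-* a _)) (e f)) (-‿+-comm _ _)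

  δ : Monomial n → Dual n
  δ m v with ≡-dec ℕ._≟_ v m
  ... | yes _ = 1#
  ... | no  _ = 0#

  δ-≡ : ∀ (m : Monomial n) → δ m m ≡ 1#
  δ-≡ m with ≡-dec ℕ._≟_ m m
  ... | yes _ = ≡.refl
  ... | no  q = ⊥-elim (q ≡.refl)

  δ-≢ : ∀ {m v : Monomial n} → v ≢ m → δ m v ≡ 0#
  δ-≢ {m = m} {v} v≢m with ≡-dec ℕ._≟_ v m
  ... | yes e = ⊥-elim (v≢m e)
  ... | no  _ = ≡.refl

  coeff-ev : ∀ p (m : Monomial n) → coeff p m ≈ ev (δ m) p
  coeff-ev []            m = refl
  coeff-ev ((a , v) ∷ p) m with ≡-dec ℕ._≟_ v m
  ... | yes _ = +-cong (sym (*-identityʳ a)) (coeff-ev p m)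
  ... | no  _ = trans (coeff-ev p m) (trans (sym (+-identityˡ _)) (+-congʳ (sym (zeroʳ a))))

  remove : Monomial n → Pol n → Pol n
  remove m []            = []
  remove m ((a , v) ∷ p) with ≡-dec ℕ._≟_ v m
  ... | yes _ = remove m p
  ... | no  _ = (a , v) ∷ remove m p

  length-remove : ∀ (m : Monomial n) p → length (remove m p) ≤ length p
  length-remove m []            = z≤n
  length-remove m ((a , v) ∷ p) with ≡-dec ℕ._≟_ v m
  ... | yes _ = ℕₚ.m≤n⇒m≤1+n (length-remove m p)
  ... | no  _ = s≤s (length-remove m p)

  ev-remove : ∀ (f : Dual n) m p → ev f p ≈ coeff p m * f m + ev f (remove m p)
  ev-remove f m []            = sym (trans (+-identityʳ _) (zeroˡ (f m)))
  ev-remove f m ((a , v) ∷ p) with ≡-dec ℕ._≟_ v m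
  ... | yes ≡.refl = trans (+-congˡ (ev-remove f m p))
        (trans (sym (+-assoc _ _ _)) (+-congʳ (sym (distribʳ (f m) a _))))
  ... | no  _      = trans (+-congˡ (ev-remove f m p)) (x∙yz≈y∙xz _ _ _)

  -- A monomial may occur several times in the list, and only its total coefficient is known to
  -- vanish. So all terms at one monomial are removed together, and the induction is on a bound for
  -- the length.
  ev-separated : ∀ (f : Dual n) p → (∀ v → coeff p v ≈ 0# ⊎ f v ≈ 0#) → ev f p ≈ 0#
  ev-separated {n} f p = go (length p) p ℕₚ.≤-refl
    where
    go : ∀ N (p : Pol n) → length p ≤ N → (∀ v → coeff p v ≈ 0# ⊎ f v ≈ 0#) → ev f p ≈ 0#
    go N       []                l s = refl
    go (suc N) p@((a , v) ∷ p′) (s≤s l) s = trans (ev-remove f v p)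
      (0+0 (product (s v)) (go N (remove v p) (ℕₚ.≤-trans shorter l) rest))
      where
      product : coeff p v ≈ 0# ⊎ f v ≈ 0# → coeff p v * f v ≈ 0#
      product (inj₁ z) = trans (*-congʳ z) (zeroˡ _)
      product (inj₂ z) = trans (*-congˡ z) (zeroʳ _)
      shorter : length (remove v p) ≤ length p′
      shorter with ≡-dec ℕ._≟_ v v
      ... | yes _ = length-remove v p′
      ... | no  q = ⊥-elim (q ≡.refl)
      coeff-remove : ∀ w → w ≢ v → coeff (remove v p) w ≈ coeff p w
      coeff-remove w w≢v = begin
        coeff (remove v p) w         ≈⟨ coeff-ev (remove v p) w ⟩
        ev (δ w) (remove v p)        ≈⟨ +-identityˡ _ ⟨
        0# + ev (δ w) (remove v p)   ≈⟨ +-congʳ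
            (trans (*-congˡ (reflexive (δ-≢ (λ e → w≢v (≡.sym e))))) (zeroʳ _)) ⟨
        coeff p v * δ w v + ev (δ w) (remove v p) ≈⟨ ev-remove (δ w) v p ⟨
        ev (δ w) p                   ≈⟨ coeff-ev p w ⟨
        coeff p w                    ∎
      removed : ∀ q → coeff (remove v q) v ≈ 0#
      removed [] = refl
      removed ((b , w) ∷ q) with ≡-dec ℕ._≟_ w v
      ... | yes _ = removed q
      ... | no w≢v with ≡-dec ℕ._≟_ w v
      ...   | yes e = ⊥-elim (w≢v e)
      ...   | no _  = removed q
      rest : ∀ w → coeff (remove v p) w ≈ 0# ⊎ f w ≈ 0#
      rest w with ≡-dec ℕ._≟_ w v
      ... | yes ≡.refl = inj₁ (removed p)
      ... | no w≢v with s w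
      ...   | inj₁ z = inj₁ (trans (coeff-remove w w≢v) z)
      ...   | inj₂ z = inj₂ z

  ev-≈P : ∀ (f : Dual n) p q → p ≈P q → ev f p ≈ ev f q
  ev-≈P f p q p≈q with ev-neg q
  ... | q⁻ , e = +-cancelʳ (- ev f q) _ _ (begin
    ev f p - ev f q    ≈⟨ +-congˡ (e f) ⟨
    ev f p + ev f q⁻   ≈⟨ ev-++ f p q⁻ ⟨
    ev f (p ++ q⁻)     ≈⟨ ev-separated f (p ++ q⁻) (λ v → inj₁ (begin
        coeff (p ++ q⁻) v            ≈⟨ coeff-ev (p ++ q⁻) v ⟩
        ev (δ v) (p ++ q⁻)           ≈⟨ ev-++ (δ v) p q⁻ ⟩
        ev (δ v) p + ev (δ v) q⁻     ≈⟨ +-cong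
            (trans (sym (coeff-ev p v)) (trans (p≈q v) (coeff-ev q v))) (e (δ v)) ⟩
        ev (δ v) q - ev (δ v) q      ≈⟨ -‿inverseʳ _ ⟩
        0#                           ∎)) ⟩
    0#                 ≈⟨ -‿inverseʳ _ ⟨
    ev f q - ev f q    ∎)

  -- Multiplication by the generators.

  evSum : Dual n → List (Monomial n) → Carrier
  evSum f L = ev f (sumMons L)

  evSum-++ : ∀ (f : Dual n) L M → evSum f (L ++ M) ≈ evSum f L + evSum f M
  evSum-++ f L M = trans (reflexive (≡.cong (ev f) (Listₚ.map-++ (1# ,_) L M)))
      (ev-++ f (sumMons L) (sumMons M))

  evSum-∷ : ∀ (f : Dual (suc n)) a L → evSum f (map (a ∷_) L) ≡ evSum (λ w → f (a ∷ w)) L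
  evSum-∷ f a []      = ≡.refl
  evSum-∷ f a (v ∷ L) = ≡.cong (1# * f (a ∷ v) +_) (evSum-∷ f a L)

  evSum-concatMap-suc : ∀ (f g : Dual n) (s t : ℕ → List (Monomial n)) →
      (∀ a → evSum f (s (suc a)) ≈ evSum g (t a)) →
    ∀ A → evSum f (concatMap s (map suc A)) ≈ evSum g (concatMap t A)
  evSum-concatMap-suc f g s t e []      = refl
  evSum-concatMap-suc f g s t e (a ∷ A) = trans (evSum-++ f (s (suc a)) _)
    (trans (+-cong (e a) (evSum-concatMap-suc f g s t e A)) (sym (evSum-++ g (t a) _)))

  H-map-suc : ∀ L d (f : Dual (suc n)) x v → H (map suc L) d f (x ∷ v) ≈ H L d (λ u → f (x ∷ u)) v
  H-map-suc L       zero    f x v = refl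
  H-map-suc []      (suc d) f x v = refl
  H-map-suc (y ∷ L) (suc d) f x v = +-cong (H-map-suc L (suc d) f x v) (H-map-suc (y ∷ L) d f x _)

  E-map-suc : ∀ L j (f : Dual (suc n)) x v → E (map suc L) j f (x ∷ v) ≈ E L j (λ u → f (x ∷ u)) v
  E-map-suc L       zero    f x v = refl
  E-map-suc []      (suc j) f x v = refl
  E-map-suc (y ∷ L) (suc j) f x v = +-cong (E-map-suc L (suc j) f x v) (E-map-suc L j f x _)

  upTo-suc : ∀ i → upTo (suc i) ≡ 0 ∷ map suc (upTo i)
  upTo-suc i = ≡.cong (0 ∷_) (≡.sym (Listₚ.map-upTo suc i))

  -- `monsSupp` sorts by the exponent a of the first variable, whereas `H` splits off one factor at
  -- a time. The terms with a = 0 form the first summand of `H`; in the others one factor is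
  -- absorbed into the head x, which is why `go` varies x.
  ⊛-monsSupp : ∀ i d (f : Dual n) → i ≤ n → f ⊛ h n d i ≐ H (upTo i) d f
  ⊛-monsSupp {zero}  zero    zero    f _ [] = trans (+-identityʳ _) (*-identityˡ _)
  ⊛-monsSupp {zero}  zero    (suc d) f _ [] = refl
  ⊛-monsSupp {suc n} zero    d       f _ (x ∷ v) = begin
    evSum (λ w → f ((x ∷ v) ⊕ w)) (map (0 ∷_) (monsSupp n 0 d)) ≡⟨ evSum-∷ _ 0 (monsSupp n 0 d) ⟩
    evSum (λ w → f (x ℕ.+ 0 ∷ (v ⊕ w))) (monsSupp n 0 d)        ≡⟨ ≡.cong
        (λ y → evSum (λ w → f (y ∷ (v ⊕ w))) (monsSupp n 0 d)) (ℕₚ.+-identityʳ x) ⟩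
    ((λ u → f (x ∷ u)) ⊛ h n d 0) v                              ≈⟨ ⊛-monsSupp 0 d
        (λ u → f (x ∷ u)) z≤n v ⟩
    H [] d (λ u → f (x ∷ u)) v                                   ≈⟨ H-map-suc [] d f x v ⟨
    H [] d f (x ∷ v)                                             ∎
  ⊛-monsSupp {suc n} (suc i) d f (s≤s i≤n) (x ∷ v) =
    ≡.subst (λ L → evSum (λ w → f ((x ∷ v) ⊕ w)) (monsSupp (suc n) (suc i) d) ≈ H L d f (x ∷ v))
        (≡.sym (upTo-suc i)) (go d x)
    where
    M = map suc (upTo i)
    first : ∀ d x → evSum (λ w → f ((x ∷ v) ⊕ w)) (map (0 ∷_) (monsSupp n i d)) ≈ H M d f (x ∷ v)
    first d x = begin
      evSum (λ w → f ((x ∷ v) ⊕ w)) (map (0 ∷_) (monsSupp n i d)) ≡⟨ evSum-∷ _ 0 (monsSupp n i d) ⟩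
      evSum (λ w → f (x ℕ.+ 0 ∷ (v ⊕ w))) (monsSupp n i d)        ≡⟨ ≡.cong
          (λ y → evSum (λ w → f (y ∷ (v ⊕ w))) (monsSupp n i d)) (ℕₚ.+-identityʳ x) ⟩
      ((λ u → f (x ∷ u)) ⊛ h n d i) v                              ≈⟨ ⊛-monsSupp i d
          (λ u → f (x ∷ u)) i≤n v ⟩
      H (upTo i) d (λ u → f (x ∷ u)) v                             ≈⟨ H-map-suc (upTo i) d f x v ⟨
      H M d f (x ∷ v)                                              ∎
    go : ∀ d x → evSum (λ w → f ((x ∷ v) ⊕ w)) (monsSupp (suc n) (suc i) d) ≈ H (0 ∷ M) d f (x ∷ v)
    go zero    x = trans (evSum-++ _ (map (0 ∷_) (monsSupp n i 0)) [])
        (trans (+-identityʳ _) (first 0 x))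
    go (suc d) x = trans (evSum-++ _ (map (0 ∷_) (monsSupp n i (suc d))) _)
        (+-cong (first (suc d) x) (begin
      evSum g (concatMap s (List.applyUpTo suc (suc d)))  ≡⟨ ≡.cong (λ A → evSum g (concatMap s A))
          (Listₚ.map-upTo suc (suc d)) ⟨
      evSum g (concatMap s (map suc (upTo (suc d))))      ≈⟨ evSum-concatMap-suc g g′ s t shift
          (upTo (suc d)) ⟩
      evSum g′ (concatMap t (upTo (suc d)))               ≈⟨ go d (suc x) ⟩
      H (0 ∷ M) d f (suc x ∷ v)                           ∎))
      where
      g g′ : Dual (suc n)
      g w = f ((x ∷ v) ⊕ w)
      g′ w = f ((suc x ∷ v) ⊕ w)
      s t : ℕ → List (Monomial (suc n))
      s a = map (a ∷_) (monsSupp n i (suc d ∸ a))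
      t a = map (a ∷_) (monsSupp n i (d ∸ a))
      shift : ∀ a → evSum g (s (suc a)) ≈ evSum g′ (t a)
      shift a = reflexive (≡.trans (evSum-∷ g (suc a) (monsSupp n i (d ∸ a)))
        (≡.trans (≡.cong (λ y → evSum (λ w → f (y ∷ (v ⊕ w))) (monsSupp n i (d ∸ a)))
            (ℕₚ.+-suc x a))
          (≡.sym (evSum-∷ g′ a (monsSupp n i (d ∸ a))))))

  ⊛-monsSqfree : ∀ j (f : Dual n) → f ⊛ e n j ≐ E (upTo n) j f
  ⊛-monsSqfree {zero}  zero    f [] = trans (+-identityʳ _) (*-identityˡ _)
  ⊛-monsSqfree {zero}  (suc j) f [] = refl
  ⊛-monsSqfree {suc n} j f (x ∷ v) =
    ≡.subst (λ L → evSum (λ w → f ((x ∷ v) ⊕ w)) (monsSqfree (suc n) j) ≈ E L j f (x ∷ v))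
        (≡.sym (upTo-suc n)) (go j)
    where
    M = map suc (upTo n)
    part : ∀ a y j → x ℕ.+ a ≡ y → evSum (λ w → f ((x ∷ v) ⊕ w))
        (map (a ∷_) (monsSqfree n j)) ≈ E M j f (y ∷ v)
    part a y j ≡.refl = begin
      evSum (λ w → f ((x ∷ v) ⊕ w)) (map (a ∷_) (monsSqfree n j)) ≡⟨ evSum-∷ _ a (monsSqfree n j) ⟩
      ((λ u → f (x ℕ.+ a ∷ u)) ⊛ e n j) v                         ≈⟨ ⊛-monsSqfree j _ v ⟩
      E (upTo n) j (λ u → f (x ℕ.+ a ∷ u)) v                      ≈⟨ E-map-suc (upTo n) j f _ v ⟨
      E M j f (x ℕ.+ a ∷ v)                                       ∎
    go : ∀ j → evSum (λ w → f ((x ∷ v) ⊕ w)) (monsSqfree (suc n) j) ≈ E (0 ∷ M) j f (x ∷ v)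
    go zero    = part 0 x 0 (ℕₚ.+-identityʳ x)
    go (suc j) = trans (evSum-++ _ (map (0 ∷_) (monsSqfree n (suc j))) _)
      (+-cong (part 0 x (suc j) (ℕₚ.+-identityʳ x)) (part 1 (suc x) j (ℕₚ.+-comm x 1)))

  upTo↭downFrom : ∀ i → upTo i ↭ downFrom i
  upTo↭downFrom i = ↭.trans (↭.↭-sym (↭ₚ.↭-reverse (upTo i))) (↭.↭-reflexive (Listₚ.reverse-upTo i))

  ⊛-h : ∀ i d (f : Dual n) → i ≤ n → f ⊛ h n d i ≐ H (downFrom i) d f
  ⊛-h i d f i≤n v = trans (⊛-monsSupp i d f i≤n v) (H-↭ (upTo↭downFrom i) d f v)

  ⊛-e : ∀ j (f : Dual n) → f ⊛ e n j ≐ E (downFrom n) j f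
  ⊛-e {n} j f v = trans (⊛-monsSqfree j f v) (E-↭ (upTo↭downFrom n) j f v)

  -- The functional f agrees with `δ m` at all monomials up to m, and p has no terms above m. So the
  -- coefficient of m in p is the value of f on p, which is 0 because f kills the generators.
  initial-stairs : ∀ n k → 1 ≤ k → k ≤ n → (p : Pol n) (m : Monomial n) →
    InIdeal (Jgens n k) p → IsInitial p m → (∀ l → l < n → at l m < k) → k ≤ stairs m → ⊥
  initial-stairs n (suc k) _ k<n p m (gs , _ , p≈) (p≉ , p≈0) small st = p≉ (begin
    coeff p m      ≈⟨ coeff-ev p m ⟩
    ev (δ m) p     ≈⟨ +-identityˡ _ ⟨
    0# + ev (δ m) p ≈⟨ +-congʳ (ev-separated (λ v → f v - δ m v) p separated) ⟨
    ev (λ v → f v - δ m v) p + ev (δ m) p ≈⟨ ev-⊞ _ (δ m) p ⟨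
    ev (λ v → f v - δ m v + δ m v) p ≈⟨ ev-cong
        (λ v → trans (+-assoc _ _ _) (trans (+-congˡ (-‿inverseˡ _)) (+-identityʳ _))) p ⟩
    ev f p         ≈⟨ ev-≈P f p (sumP (zipWith _*P_ gs (Jgens n (suc k)))) p≈ ⟩
    ev f (sumP (zipWith _*P_ gs (Jgens n (suc k)))) ≈⟨ ev-combination f gs killed ⟩
    0# ∎)
    where
    F₀ = functional (suc k) m small st n ℕₚ.≤-refl
    f = proj₁ F₀
    K : Kills (suc k) n 0 f
    K = ≡.subst (λ c → Kills (suc k) n c f) (stairsFrom-end m) (proj₁ (proj₂ F₀))
    lead = proj₂ (proj₂ F₀)
    killed : All (λ g → Vanishes (f ⊛ g)) (Jgens n (suc k))
    killed = Allₚ.++⁺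
      (Allₚ.map⁺ (Allₚ.applyUpTo⁺₁ (λ i → i) n (λ {i} i<n v → trans (⊛-h (suc i) (suc k) f i<n v)
        (Kills.killsH K (suc i) k (ℕₚ.≤-trans i<n (ℕₚ.≤-reflexive (≡.sym (ℕₚ.+-identityʳ n))))
            (ℕₚ.m≤m+n (suc k) _) v))))
      (Allₚ.map⁺ (Allₚ.applyUpTo⁺₁ (λ i → i) (suc k) (λ {j} j<k v → trans (⊛-e (n ∸ j) f v)
        (≡.subst (λ N → Vanishes (E (downFrom N) (n ∸ j) f)) (ℕₚ.+-identityʳ n)
          (Kills.killsE K (n ∸ j) (≡.subst (_< n ∸ j ℕ.+ suc k) (≡.sym (ℕₚ.+-identityʳ n))
              (bound j<k))) v))))
      where
      bound : ∀ {j} → j < suc k → n < n ∸ j ℕ.+ suc k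
      bound {j} j<k = ℕₚ.≤-<-trans (ℕₚ.≤-reflexive
          (≡.sym (ℕₚ.m∸n+n≡m (ℕₚ.≤-trans (ℕₚ.<⇒≤ j<k) k<n)))) (ℕₚ.+-monoʳ-< (n ∸ j) j<k)
    separated : ∀ v → coeff p v ≈ 0# ⊎ f v - δ m v ≈ 0#
    separated v with ≺-cmp v m
    ... | inj₁ v≺m = inj₂ (trans (+-cong (≡.subst₂ (λ a b → a ≺ b → f a ≈ 0#) (trunc-full v)
          (trunc-full m) (proj₁ lead v) v≺m)
            (trans (-‿cong (reflexive (δ-≢ {m = m} {v} (λ { ≡.refl → ≺-irrefl v≺m })))) -0#≈0#))
                (+-identityʳ 0#))
    ... | inj₂ (inj₁ ≡.refl) = inj₂ (trans (+-cong
          (trans (reflexive (≡.cong f (≡.sym (trunc-full m)))) (proj₂ lead))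
            (-‿cong (reflexive (δ-≡ m)))) (-‿inverseʳ 1#))
    ... | inj₂ (inj₂ m≺v) = inj₁ (p≈0 v (≺⇒<nl m≺v))

  -- Polynomials with a prescribed initial monomial

  -- Testing equality on all functionals makes the transposed identities directly applicable; the
  -- functionals `δ m` recover the coefficients.
  ≈ev : Pol n → Pol n → Set (c ⊔ ℓ)
  ≈ev p q = ∀ f → ev f p ≈ ev f q

  mulX : ℕ → Pol n → Pol n
  mulX x = map (λ { (a , v) → a , bump x v })

  ev-mulX : ∀ x (f : Dual n) p → ev f (mulX x p) ≈ ev (X x f) p
  ev-mulX x f []      = refl
  ev-mulX x f (_ ∷ p) = +-congˡ (ev-mulX x f p)

  neg : Pol n → Pol n
  neg p = proj₁ (ev-neg p)

  neg-linear : LinearOp {n} (λ _ → ⊤) (λ f v → - f v)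
  neg-linear = record
    { T-cong = λ p v → -‿cong (p tt v)
    ; T-⊞    = λ g h v → sym (-‿+-comm _ _)
    ; T-X    = λ _ g v → refl
    }

  ev-neg-dual : ∀ (f : Dual n) p → ev f (neg p) ≈ ev (λ v → - f v) p
  ev-neg-dual f p = trans (proj₂ (ev-neg p) f) (go p)
    where
    go : ∀ p → - ev f p ≈ ev (λ v → - f v) p
    go []            = -0#≈0#
    go ((a , v) ∷ p) = trans (sym (-‿+-comm _ _)) (+-cong (-‿distribʳ-* a _) (go p))

  ddMon : ℕ → ℕ → Monomial n → Pol (2 ℕ.+ n)
  ddMon zero    zero    v = []
  ddMon zero    (suc q) v = (- 1# , 0 ∷ q ∷ v) ∷ mulX 0 (ddMon 0 q v)
  ddMon (suc p) q       v = (1# , p ∷ q ∷ v) ∷ mulX 1 (ddMon p q v)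

  ev-ddMon : ∀ (f : Dual (2 ℕ.+ n)) p q v → ev f (ddMon p q v) ≈ D (λ s t → f (s ∷ t ∷ v)) p q
  ev-ddMon f zero    zero    v = refl
  ev-ddMon f zero    (suc q) v = +-cong (trans (sym (-‿distribˡ-* 1# _)) (-‿cong (*-identityˡ _)))
    (trans (ev-mulX 0 f (ddMon 0 q v)) (ev-ddMon (X 0 f) 0 q v))
  ev-ddMon f (suc p) q       v = +-cong (*-identityˡ _)
    (trans (ev-mulX 1 f (ddMon p q v)) (ev-ddMon (X 1 f) p q v))

  ddTerm : ℕ → Monomial n → Pol n
  ddTerm i       []          = []
  ddTerm zero    (x ∷ [])    = []
  ddTerm zero    (p ∷ q ∷ v) = ddMon p q v
  ddTerm (suc i) (x ∷ v)     = map (λ { (a , w) → a , x ∷ w }) (ddTerm i v)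

  ev-ddTerm : ∀ i (f : Dual n) v → ev f (ddTerm i v) ≈ dd i f v
  ev-ddTerm i       f []          = refl
  ev-ddTerm zero    f (x ∷ [])    = refl
  ev-ddTerm zero    f (p ∷ q ∷ v) = ev-ddMon f p q v
  ev-ddTerm (suc i) f (x ∷ v)     = trans (go (ddTerm i v)) (ev-ddTerm i (λ u → f (x ∷ u)) v)
    where
    go : ∀ p → ev f (map (λ { (a , w) → a , x ∷ w }) p) ≈ ev (λ u → f (x ∷ u)) p
    go []      = refl
    go (_ ∷ p) = +-congˡ (go p)

  dividedDifference : ℕ → Pol n → Pol n
  dividedDifference i = concatMap (λ { (a , v) → map (λ { (b , w) → a * b , w }) (ddTerm i v) })

  ev-dividedDifference : ∀ i (f : Dual n) p → ev f (dividedDifference i p) ≈ ev (dd i f) p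
  ev-dividedDifference i f []            = refl
  ev-dividedDifference i f ((a , v) ∷ p) = trans (ev-++ f (map _ (ddTerm i v)) _)
    (+-cong (trans (scale (ddTerm i v)) (*-congˡ (ev-ddTerm i f v))) (ev-dividedDifference i f p))
    where
    scale : ∀ q → ev f (map (λ { (b , w) → a * b , w }) q) ≈ a * ev f q
    scale []            = sym (zeroʳ a)
    scale ((b , w) ∷ q) = trans (+-cong (*-assoc a b _) (scale q)) (sym (distribˡ a _ _))

  -- The ideal generated by e_n, …, e_{n-k+1}.
  data InE (k : ℕ) : Pol n → Set (c ⊔ ℓ) where
    none : ∀ {p : Pol n} → (∀ f → ev f p ≈ 0#) → InE k p
    term : ∀ {p : Pol n} j q r → j < k →
      (∀ f → ev f p ≈ ev (E (downFrom n) (n ∸ j) f) q + ev f r) → InE k r → InE k p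

  inE-resp : ∀ {p q : Pol n} → ≈ev p q → InE k q → InE k p
  inE-resp e (none z)       = none (λ f → trans (e f) (z f))
  inE-resp e (term j q r l s R) = term j q r l (λ f → trans (e f) (s f)) R

  inE-++ : ∀ {p q : Pol n} → InE k p → InE k q → InE k (p ++ q)
  inE-++ {p = p} {q} (none z) Q = inE-resp (λ f →
      trans (ev-++ f p q) (trans (+-congʳ (z f)) (+-identityˡ _))) Q
  inE-++ {p = p} {q} (term j t r l s R) Q = term j t (r ++ q) l
    (λ f → trans (ev-++ f p q) (trans (+-congʳ (s f))
        (trans (+-assoc _ _ _) (+-congˡ (sym (ev-++ f r q))))))
    (inE-++ R Q)

  -- If Φ is linear over the elementary symmetric polynomials, it can be applied to each multiplier.
  -- This covers negation, multiplication by a variable and divided differences.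
  inE-map : ∀ (Φ : Pol n → Pol n) (T : Dual n → Dual n) → (∀ f p → ev f (Φ p) ≈ ev (T f) p) →
    (∀ j f → E (downFrom n) j (T f) ≐ T (E (downFrom n) j f)) → ∀ {p} → InE k p → InE k (Φ p)
  inE-map Φ T e comm {p} (none z) = none (λ f → trans (e f p) (z (T f)))
  inE-map {n} Φ T e comm {p} (term j q r l s R) = term j (Φ q) (Φ r) l
    (λ f → trans (e f p) (trans (s (T f)) (+-cong
      (trans (ev-cong (comm (n ∸ j) f) q) (sym (e _ q))) (sym (e f r)))))
    (inE-map Φ T e comm R)

  inE-dividedDifference : ∀ {i} {p : Pol n} → suc i < n → InE k p → InE k (dividedDifference i p)
  inE-dividedDifference {n} {i = i} i<n = inE-map (dividedDifference i) (dd i)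
      (ev-dividedDifference i)
    (λ j f → ≡.subst (λ N → E (downFrom N) j (dd i f) ≐ dd i (E (downFrom N) j f)) (ℕₚ.m∸n+n≡m i<n)
      (E-dd-above i i<n (n ∸ (2 ℕ.+ i)) j f))

  record IsIdeal (K : Pol n → Set (c ⊔ ℓ)) : Set (c ⊔ ℓ) where
    field
      resp : ∀ {p q} → ≈ev p q → K q → K p
      nil  : K []
      add  : ∀ {p q} → K p → K q → K (p ++ q)
      opp  : ∀ {p} → K p → K (neg p)
      mul  : ∀ x {p} → K p → K (mulX x p)

    vanishing : ∀ {p} → (∀ f → ev f p ≈ 0#) → K p
    vanishing z = resp z nil

    cancel : ∀ {p q} → K p → K (p ++ q) → K q
    cancel {p} {q} P PQ = resp (λ f → sym (begin
      ev f (neg p ++ p ++ q)           ≈⟨ ev-++ f (neg p) (p ++ q) ⟩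
      ev f (neg p) + ev f (p ++ q)     ≈⟨ +-cong (proj₂ (ev-neg p) f) (ev-++ f p q) ⟩
      - ev f p + (ev f p + ev f q)     ≈⟨ +-assoc _ _ _ ⟨
      - ev f p + ev f p + ev f q       ≈⟨ trans (+-congʳ (-‿inverseˡ _)) (+-identityˡ _) ⟩
      ev f q                           ∎)) (add (opp P) PQ)

  inE-isIdeal : IsIdeal {n} (InE k)
  inE-isIdeal {n} = record
    { resp = inE-resp
    ; nil  = none (λ f → refl)
    ; add  = inE-++
    ; opp  = inE-map neg (λ f v → - f v) ev-neg-dual
               (λ j f → Linear.E-T neg-linear (everywhere (downFrom n)) j (λ _ → f))
    ; mul  = λ x → inE-map (mulX x) (X x) (ev-mulX x)
               (λ j f → Xₗ.E-T x (everywhere (downFrom n)) j (λ _ → f))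
    }

  -- Colon ideals and powers of products of variables.

  colon : ∀ {K : Pol n → Set (c ⊔ ℓ)} x → IsIdeal K → IsIdeal (λ p → K (mulX x p))
  colon x I = record
    { resp = λ {p} {q} e → resp (λ f → trans (ev-mulX x f p)
        (trans (e (X x f)) (sym (ev-mulX x f q))))
    ; nil  = nil
    ; add  = λ {p} {q} P Q → resp (λ f → trans (ev-mulX x f (p ++ q)) (trans (ev-++ (X x f) p q)
               (trans (sym (+-cong (ev-mulX x f p) (ev-mulX x f q)))
                   (sym (ev-++ f (mulX x p) (mulX x q)))))) (add P Q)
    ; opp  = λ {p} P → resp (λ f → trans (ev-mulX x f (neg p)) (trans (proj₂ (ev-neg p) (X x f))
               (trans (-‿cong (sym (ev-mulX x f p))) (sym (proj₂ (ev-neg (mulX x p)) f))))) (opp P)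
    ; mul  = λ y {p} P → resp (λ f → begin
               ev f (mulX x (mulX y p))   ≈⟨ trans (ev-mulX x f (mulX y p)) (ev-mulX y (X x f) p) ⟩
               ev (X y (X x f)) p         ≈⟨ ev-cong
                   (λ v → reflexive (≡.cong f (bump-comm x y v))) p ⟩
               ev (X x (X y f)) p         ≈⟨ trans (ev-mulX y f (mulX x p)) (ev-mulX x (X y f) p) ⟨
               ev f (mulX y (mulX x p))   ∎) (mul y P)
    }
    where open IsIdeal I

  mulXs : List ℕ → Pol n → Pol n
  mulXs []      p = p
  mulXs (x ∷ L) p = mulX x (mulXs L p)

  colons : ∀ {K : Pol n → Set (c ⊔ ℓ)} L → IsIdeal K → IsIdeal (λ p → K (mulXs L p))
  colons []      I = I
  colons (x ∷ L) I = colons L (colon x I)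

  muls : ∀ {K : Pol n → Set (c ⊔ ℓ)} L → IsIdeal K → ∀ {p} → K p → K (mulXs L p)
  muls []      I P = P
  muls (x ∷ L) I P = IsIdeal.mul I x (muls L I P)

  one : Pol n
  one = (1# , 0s) ∷ []

  elem : List ℕ → ℕ → Pol n
  elem L       zero    = one
  elem []      (suc j) = []
  elem (x ∷ L) (suc j) = elem L (suc j) ++ mulX x (elem L j)

  ev-elem : ∀ L j (f : Dual n) → ev f (elem L j) ≈ E L j f 0s
  ev-elem L       zero    f = trans (+-identityʳ _) (*-identityˡ _)
  ev-elem []      (suc j) f = refl
  ev-elem (x ∷ L) (suc j) f = trans (ev-++ f (elem L (suc j)) _) (+-cong (ev-elem L (suc j) f)
    (trans (ev-mulX x f (elem L j)) (trans (ev-elem L j (X x f)) (sym (E-X x L j f 0s)))))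

  ev-elem-large : ∀ L j (f : Dual n) → length L < j → ev f (elem L j) ≈ 0#
  ev-elem-large []      (suc j) f _       = refl
  ev-elem-large (x ∷ L) (suc j) f (s≤s l) = trans (ev-++ f (elem L (suc j)) _)
    (0+0 (ev-elem-large L (suc j) f (ℕₚ.m≤n⇒m≤1+n l))
        (trans (ev-mulX x f (elem L j)) (ev-elem-large L j (X x f) l)))

  module _ {K : Pol n → Set (c ⊔ ℓ)} (I : IsIdeal K) where
    open IsIdeal I

    -- A squarefree monomial takes at most |L| of its factors from L, so at least J of them come
    -- from M.
    elem-++ : ∀ L {M J} → (∀ j → J ≤ j → K (elem M j)) → ∀ j → length L ℕ.+ J ≤ j →
        K (elem (L ++ M) j)
    elem-++ []      e j       p       = e j p
    elem-++ (x ∷ L) e (suc j) (s≤s p) = add (elem-++ L e (suc j) (ℕₚ.m≤n⇒m≤1+n p))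
        (mul x (elem-++ L e j p))

  -- Modulo the e_{j'}(M) with j' > j, e_{|L|+j}(L ∪ M) is (∏ L) e_j(M).
  elem-top : ∀ {K : Pol n → Set (c ⊔ ℓ)} → IsIdeal K → ∀ L {M j} → (∀ j′ → j < j′ → K (elem M j′)) →
    K (elem (L ++ M) (length L ℕ.+ j)) → K (mulXs L (elem M j))
  elem-top I []      e P = P
  elem-top I (x ∷ L) {j = j} e P = elem-top (colon x I) L (λ j′ p → mul x (e j′ p))
    (cancel (elem-++ I L e (suc (length L ℕ.+ j)) (ℕₚ.≤-reflexive (ℕₚ.+-suc (length L) j))) P)
    where open IsIdeal I

  mulXs^ : List ℕ → ℕ → Pol n → Pol n
  mulXs^ L zero    p = p
  mulXs^ L (suc i) p = mulXs^ L i (mulXs L p)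

  colons^ : ∀ {K : Pol n → Set (c ⊔ ℓ)} L i → IsIdeal K → IsIdeal (λ p → K (mulXs^ L i p))
  colons^ L zero    I = I
  colons^ L (suc i) I = colons L (colons^ L i I)

  muls^ : ∀ {K : Pol n → Set (c ⊔ ℓ)} L i → IsIdeal K → ∀ {p} → K p → K (mulXs^ L i p)
  muls^ L zero    I P = P
  muls^ L (suc i) I P = muls^ L i I (muls L I P)

  -- (∏ L)^i e_j(M) lies in the ideal for i + j > |M|, by induction on i.
  power-elem : ∀ {K : Pol n → Set (c ⊔ ℓ)} → IsIdeal K → ∀ L M →
      (∀ j → length L ≤ j → K (elem (L ++ M) j)) →
    ∀ i j → length M < i ℕ.+ j → K (mulXs^ L i (elem M j))
  power-elem I L M e zero    j p = IsIdeal.vanishing I (λ f → ev-elem-large M j f p)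
  power-elem I L M e (suc i) j p = elem-top (colons^ L i I) L
    (λ j′ q → power-elem I L M e i j′ (ℕₚ.<-≤-trans p
        (ℕₚ.≤-trans (ℕₚ.≤-reflexive (≡.sym (ℕₚ.+-suc i j))) (ℕₚ.+-monoʳ-≤ i q))))
    (muls^ L i I (e (length L ℕ.+ j) (ℕₚ.m≤m+n _ j)))

  -- p is monic with initial monomial m.
  Leading : Pol n → Monomial n → Set (c ⊔ ℓ)
  Leading {n} p m = ∀ (f : Dual n) → (∀ v → v ≺ m → f v ≈ 0#) → ev f p ≈ f m

  leading⇒initial : ∀ (p : Pol n) m → Leading p m → IsInitial p m
  leading⇒initial p m le =
    (λ z → 0≉1 (trans (sym z) (trans (coeff-ev p m) (trans
      (le (δ m) (λ v v≺m → reflexive (δ-≢ {m = m} {v} (λ { ≡.refl → ≺-irrefl v≺m }))))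
          (reflexive (δ-≡ m)))))) ,
    (λ m′ m<m′ → trans (coeff-ev p m′) (trans
      (le (δ m′) (λ v v≺m → reflexive (δ-≢ {m = m′} {v}
          (λ { ≡.refl → ≺-asym v≺m (<nl⇒≺ {v = m} {m′} m<m′) }))))
      (reflexive (δ-≢ {m = m′} {m} (λ { ≡.refl → ≺-irrefl (<nl⇒≺ {v = m} {m′} m<m′) })))))

  -- Initial monomials under divided differences.

  headExp : Bool → ℕ → ℕ
  headExp true  z = suc z
  headExp false z = 0

  skipMon-head : ∀ x (b : Vec Bool n) → skipMon 0 (x ∷ b) ≡ headExp x (zeros b) ∷ skipMon 0 b
  skipMon-head true  b = ≡.refl
  skipMon-head false b = ≡.refl

  -- A divided difference moves the initial exponents (a + 1, 0) at i, i + 1 to (0, a).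
  dd-swap : ∀ {i} {b b′ : Vec Bool n} → Swap i b b′ → ∀ (f : Dual n) →
      (∀ v → v ≺ skipMon 0 b′ → f v ≈ 0#) →
    (∀ v → v ≺ skipMon 0 b → dd i f v ≈ 0#) × dd i f (skipMon 0 b) ≈ f (skipMon 0 b′)
  dd-swap {b = true ∷ false ∷ b} here f z = below ,
    D-lead (suc (zeros b)) (λ s t t<z → z (s ∷ t ∷ skipMon 0 b) (there (here t<z)))
    where
    below : ∀ v → v ≺ skipMon 0 (true ∷ false ∷ b) → dd 0 f v ≈ 0#
    below (p ∷ q ∷ v) (there (there r)) = D-0 p q (λ s t → z _ (there (there r)))
      where
      D-0 : ∀ {g} p q → (∀ s t → g s t ≈ 0#) → D g p q ≈ 0#
      D-0 zero    zero    e = refl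
      D-0 zero    (suc q) e = 0+0 (trans (-‿cong (e 0 q)) -0#≈0#) (D-0 0 q (λ s t → e (suc s) t))
      D-0 (suc p) q       e = 0+0 (e p q) (D-0 p q (λ s t → e s (suc t)))
    below (p ∷ zero ∷ v) (here (s≤s p≤z)) =
      D-vanishes p (λ s t t<p → z _ (there (here (ℕₚ.<-≤-trans t<p p≤z))))
  dd-swap {i = suc i} {x ∷ b} {x ∷ b′} (there s) f z
    rewrite skipMon-head x b | skipMon-head x b′ | zeros-swap s = below , proj₂ (IH y z′)
    where
    y = headExp x (zeros b′)
    z′ : ∀ v → v ≺ skipMon 0 b′ → f (y ∷ v) ≈ 0#
    z′ v p = z _ (there p)
    -- The head w must vary: the vectors below include those with the same tail and a head w < y,
    -- whose value is that of f at w over the new tail, again below the target.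
    IH : ∀ w → (∀ v → v ≺ skipMon 0 b′ → f (w ∷ v) ≈ 0#) →
      (∀ v → v ≺ skipMon 0 b → dd i (λ u → f (w ∷ u)) v ≈ 0#) ×
          dd i (λ u → f (w ∷ u)) (skipMon 0 b) ≈ f (w ∷ skipMon 0 b′)
    IH w = dd-swap s (λ u → f (w ∷ u))
    below : ∀ v → v ≺ y ∷ skipMon 0 b → dd (suc i) f v ≈ 0#
    below (w ∷ v) (there p) = proj₁ (IH w (λ v p → z _ (there p))) v p
    below (w ∷ .(skipMon 0 b)) (here w<y) = trans (proj₂ (IH w (λ v p → z _ (there p))))
        (z _ (here w<y))

  leading-swap : ∀ {i} {b b′ : Vec Bool n} → Swap i b b′ → ∀ p → Leading p (skipMon 0 b) →
    Leading (dividedDifference i p) (skipMon 0 b′)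
  leading-swap {i = i} s p le f z with dd-swap s f z
  ... | below , equal = trans (ev-dividedDifference i f p) (trans (le (dd i f) below) equal)

  -- The monomial of the sorted word.

  bumps : List ℕ → Monomial n → Monomial n
  bumps []      v = v
  bumps (x ∷ L) v = bump x (bumps L v)

  mulXs-mono : ∀ L (v : Monomial n) → mulXs L ((1# , v) ∷ []) ≡ (1# , bumps L v) ∷ []
  mulXs-mono []      v = ≡.refl
  mulXs-mono (x ∷ L) v rewrite mulXs-mono L v = ≡.refl

  bumps-map-suc : ∀ L x (v : Monomial n) → bumps (map suc L) (x ∷ v) ≡ x ∷ bumps L v
  bumps-map-suc []      x v = ≡.refl
  bumps-map-suc (y ∷ L) x v rewrite bumps-map-suc L x v = ≡.refl

  -- (x_1 ⋯ x_d)^j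
  block : ℕ → ℕ → Monomial n
  block         zero    j = 0s
  block {zero}  (suc d) j = []
  block {suc n} (suc d) j = j ∷ block d j

  bumps-block : ∀ d j → bumps (upTo d) (block {n} d j) ≡ block d (suc j)
  bumps-block         zero    j = ≡.refl
  bumps-block {zero}  (suc d) j = vec0 _
    where
    vec0 : ∀ (v : Monomial 0) → v ≡ []
    vec0 [] = ≡.refl
  bumps-block {suc n} (suc d) j = ≡.trans
    (≡.cong (λ L → bump 0 (bumps L (j ∷ block d j))) (≡.sym (Listₚ.map-upTo suc d)))
    (≡.trans (≡.cong (bump 0) (bumps-map-suc (upTo d) j (block d j)))
        (≡.cong (suc j ∷_) (bumps-block d j)))

  mulXs^-block : ∀ d i j → mulXs^ (upTo d) i ((1# , block {n} d j) ∷ []) ≡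
      (1# , block d (i ℕ.+ j)) ∷ []
  mulXs^-block d zero    j = ≡.refl
  mulXs^-block {n} d (suc i) j rewrite mulXs-mono (upTo d) (block {n} d j) | bumps-block {n} d j =
    ≡.trans (mulXs^-block d i (suc j)) (≡.cong (λ x → (1# , block d x) ∷ []) (ℕₚ.+-suc i j))

  block-0 : ∀ d → block {n} d 0 ≡ 0s
  block-0         zero    = ≡.refl
  block-0 {zero}  (suc d) = ≡.refl
  block-0 {suc n} (suc d) = ≡.cong (0 ∷_) (block-0 d)

  zeros-sorted : ∀ n z → z ≤ n → zeros (sorted n z) ≡ z
  zeros-sorted zero    .0 z≤n = ≡.refl
  zeros-sorted (suc n) z p with z ℕ.≤? n
  ... | yes q = zeros-sorted n z q
  ... | no q with ℕₚ.≤-antisym p (ℕₚ.≰⇒> q)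
  ...   | ≡.refl = ≡.cong suc (zeros-sorted n n ℕₚ.≤-refl)

  skipMon-sorted : ∀ n z → z ≤ n → skipMon 0 (sorted n z) ≡ block (n ∸ z) (suc z)
  skipMon-sorted zero    .0 z≤n = ≡.refl
  skipMon-sorted (suc n) z p with z ℕ.≤? n
  ... | yes q rewrite ℕₚ.+-∸-assoc 1 q | zeros-sorted n z q =
        ≡.cong (suc z ∷_) (skipMon-sorted n z q)
  ... | no q with ℕₚ.≤-antisym p (ℕₚ.≰⇒> q)
  ...   | ≡.refl with skipMon-sorted n n ℕₚ.≤-refl
  ...     | e rewrite ℕₚ.n∸n≡0 n = ≡.cong (0 ∷_) e

  upTo-++ : ∀ (f : ℕ → ℕ) d z → List.applyUpTo f d ++ List.applyUpTo
      (λ i → f (d ℕ.+ i)) z ≡ List.applyUpTo f (d ℕ.+ z)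
  upTo-++ f zero    z = ≡.refl
  upTo-++ f (suc d) z = ≡.cong (f 0 ∷_) (upTo-++ (λ i → f (suc i)) d z)

  inE-elem : ∀ n z → z < n → ∀ j → n ∸ z ≤ j → InE (suc z) {n} (elem (upTo n) j)
  inE-elem n z z<n j p with j ℕ.≤? n
  ... | no j≰n = none (λ f → ev-elem-large (upTo n) j f
        (ℕₚ.≤-<-trans (ℕₚ.≤-reflexive (Listₚ.length-upTo n)) (ℕₚ.≰⇒> j≰n)))
  ... | yes j≤n = term (n ∸ j) one []
    (s≤s (ℕₚ.≤-trans (ℕₚ.∸-monoʳ-≤ n p) (ℕₚ.≤-reflexive (ℕₚ.m∸[m∸n]≡n (ℕₚ.<⇒≤ z<n)))))
    (λ f → begin
      ev f (elem (upTo n) j)                    ≈⟨ ev-elem (upTo n) j f ⟩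
      E (upTo n) j f 0s                         ≈⟨ E-↭ (upTo↭downFrom n) j f 0s ⟩
      E (downFrom n) j f 0s                     ≡⟨ ≡.cong (λ i → E (downFrom n) i f 0s)
          (ℕₚ.m∸[m∸n]≡n j≤n) ⟨
      E (downFrom n) (n ∸ (n ∸ j)) f 0s         ≈⟨ *-identityˡ _ ⟨
      1# * E (downFrom n) (n ∸ (n ∸ j)) f 0s    ≈⟨ +-identityʳ _ ⟨
      ev (E (downFrom n) (n ∸ (n ∸ j)) f) one   ≈⟨ +-identityʳ _ ⟨
      ev (E (downFrom n) (n ∸ (n ∸ j)) f) one + 0# ∎)
    (none (λ f → refl))

  -- With L the first n - z variables and M the other z, the exponent z + 1 exceeds |M|, so
  -- `power-elem` applies to e_0(M) = 1.
  inE-block : ∀ n z → z < n → InE (suc z) {n} ((1# , block (n ∸ z) (suc z)) ∷ [])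
  inE-block n z z<n = ≡.subst (InE (suc z))
    (≡.trans (≡.cong (λ v → mulXs^ L (suc z) ((1# , v) ∷ [])) (≡.sym (block-0 (n ∸ z))))
      (≡.trans (mulXs^-block (n ∸ z) (suc z) 0)
          (≡.cong (λ i → (1# , block (n ∸ z) i) ∷ []) (ℕₚ.+-identityʳ (suc z)))))
    (power-elem inE-isIdeal L M gens (suc z) 0
      (ℕₚ.≤-reflexive (≡.cong suc (≡.trans (Listₚ.length-applyUpTo _ z)
          (≡.sym (ℕₚ.+-identityʳ z))))))
    where
    L = upTo (n ∸ z)
    M = List.applyUpTo (λ i → n ∸ z ℕ.+ i) z
    gens : ∀ j → length L ≤ j → InE (suc z) (elem (L ++ M) j)
    gens j p rewrite upTo-++ (λ i → i) (n ∸ z) z | ℕₚ.m∸n+n≡m (ℕₚ.<⇒≤ z<n) =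
      inE-elem n z z<n j (ℕₚ.≤-trans (ℕₚ.≤-reflexive (≡.sym (Listₚ.length-upTo (n ∸ z)))) p)

  skip-leading : ∀ (b : Vec Bool n) → zeros b < n → Σ (Pol n) λ p → InE (suc (zeros b)) p ×
      Leading p (skipMon 0 b)
  skip-leading {n} b z<n = bubble b (λ b′ → Σ (Pol n) λ p → InE (suc (zeros b)) p ×
      Leading p (skipMon 0 b′))
    (λ { {i} s (p , P , le) → dividedDifference i p , inE-dividedDifference
        (swap-inRange s) P , leading-swap s p le })
    ((1# , m) ∷ [] , inE-block n (zeros b) z<n , λ f _ →
      trans (+-identityʳ _) (trans (*-identityˡ _)
          (reflexive (≡.cong f (≡.sym (skipMon-sorted n (zeros b) (ℕₚ.<⇒≤ z<n)))))))
    where m = block (n ∸ zeros b) (suc (zeros b))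

  -- The complete homogeneous generators

  bump-put : ∀ i a → i < n → bump i (put i a (0s {n})) ≡ put i (suc a) 0s
  bump-put {suc n} zero    a _       = ≡.refl
  bump-put {suc n} (suc i) a (s≤s l) = ≡.cong (0 ∷_) (bump-put i a l)

  -- Below index i the right-hand exponents are 0, and nothing is smaller than 0. So the comparison
  -- is decided at index i, which bumping j < i leaves alone.
  bump-≺-put : ∀ i {j b} {u : Monomial n} → u ≺ put i b 0s → j < i → bump j u ≺ put i b 0s
  bump-≺-put {suc n} (suc i) {zero}          (there p) _       = there p
  bump-≺-put {suc n} (suc i) {suc j}         (there p) (s≤s l) = there (bump-≺-put i p l)

  put-≺-put : ∀ i {a b} → i < n → a < b → put i a (0s {n}) ≺ put i b 0s
  put-≺-put {suc n} zero    _       a<b = here a<b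
  put-≺-put {suc n} (suc i) (s≤s l) a<b = there (put-≺-put i l a<b)

  H-local : ∀ (Q : Monomial n → Set) {i} → (∀ {j u} → j < i → Q u → Q (bump j u)) →
    ∀ {f : Dual n} → (∀ u → Q u → f u ≈ 0#) → ∀ {i′} → i′ ≤ i → ∀ d {v} → Q v →
        H (downFrom i′) (suc d) f v ≈ 0#
  H-local Q cl z {zero}   _ d       q = refl
  H-local Q cl z {suc i′} l zero    q = 0+0 (H-local Q cl z (ℕₚ.<⇒≤ l) zero q) (z _ (cl l q))
  H-local Q cl z {suc i′} l (suc d) q = 0+0 (H-local Q cl z (ℕₚ.<⇒≤ l) (suc d) q)
      (H-local Q cl z l d (cl l q))

  -- In h_{d+1}(L, y) = h_{d+1}(L) + y h_d(L, y) the first summand leaves the exponent a of y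
  -- unchanged, so its terms stay below y^{d+1+a} and f kills them. The induction continues with a +
  -- 1.
  H-lead : ∀ {i} → i < n → ∀ d a (f : Dual n) → (∀ u → u ≺ put i (d ℕ.+ a) 0s → f u ≈ 0#) →
    H (downFrom (suc i)) d f (put i a 0s) ≈ f (put i (d ℕ.+ a) 0s)
  H-lead {i = i} i<n zero    a f z = refl
  H-lead {n} {i} i<n (suc d) a f z = trans (+-cong
    (H-local (λ u → u ≺ put i (suc d ℕ.+ a) 0s) (λ j<i p → bump-≺-put i p j<i) z ℕₚ.≤-refl d
      (put-≺-put i i<n (s≤s (ℕₚ.m≤n+m a d))))
    (trans (reflexive (≡.cong (H (downFrom (suc i)) d f) (bump-put i a i<n)))
      (trans (H-lead i<n d (suc a) f (≡.subst (λ x → ∀ u → u ≺ put i x 0s → f u ≈ 0#)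
          (≡.sym (ℕₚ.+-suc d a)) z))
        (reflexive (≡.cong (λ x → f (put i x 0s)) (ℕₚ.+-suc d a)))))) (+-identityˡ _)

  0s-⊕ : ∀ (v : Monomial n) → 0s ⊕ v ≡ v
  0s-⊕ []      = ≡.refl
  0s-⊕ (x ∷ v) = ≡.cong (x ∷_) (0s-⊕ v)

  put-0 : ∀ i → put i 0 (0s {n}) ≡ 0s
  put-0 {zero}  i       = ≡.refl
  put-0 {suc n} zero    = ≡.refl
  put-0 {suc n} (suc i) = ≡.cong (0 ∷_) (put-0 i)

  h-leading : ∀ k {i} → i < n → Leading (h n k (suc i)) (put i k 0s)
  h-leading {n} k {i} i<n f z = begin
    ev f (h n k (suc i))                    ≈⟨ ev-cong (λ v → reflexive (≡.cong f (≡.sym (0s-⊕ v))))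
        (h n k (suc i)) ⟩
    (f ⊛ h n k (suc i)) 0s                  ≈⟨ ⊛-h (suc i) k f i<n 0s ⟩
    H (downFrom (suc i)) k f 0s             ≡⟨ ≡.cong (H (downFrom (suc i)) k f) (put-0 i) ⟨
    H (downFrom (suc i)) k f (put i 0 0s)   ≈⟨ H-lead i<n k 0 f
        (≡.subst (λ x → ∀ u → u ≺ put i x 0s → f u ≈ 0#) (≡.sym (ℕₚ.+-identityʳ k)) z) ⟩
    f (put i (k ℕ.+ 0) 0s)                  ≡⟨ ≡.cong (λ x → f (put i x 0s)) (ℕₚ.+-identityʳ k) ⟩
    f (put i k 0s)                          ∎

  -- Membership in the ideal

  Combination : List (Pol n) → Pol n → Set (c ⊔ ℓ)
  Combination {n} gens p = Σ (List (Pol n)) λ gs →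
    (length gs ≡ length gens) × ≈ev p (sumP (zipWith _*P_ gs gens))

  combination⇒inIdeal : ∀ {gens} (p : Pol n) → Combination gens p → InIdeal gens p
  combination⇒inIdeal {gens = gens} p (gs , l , e) =
      gs , l , λ m → trans (coeff-ev p m) (trans (e (δ m))
      (sym (coeff-ev (sumP (zipWith _*P_ gs gens)) m)))

  combination-zero : ∀ (gens : List (Pol n)) p → (∀ f → ev f p ≈ 0#) → Combination gens p
  combination-zero gens p z = map (λ _ → []) gens , Listₚ.length-map _ gens , λ f →
      trans (z f) (sym (go gens f))
    where
    go : ∀ gens f → ev f (sumP (zipWith _*P_ (map (λ _ → []) gens) gens)) ≈ 0#
    go []         f = refl
    go (g ∷ gens) f = go gens f

  -- `InIdeal` has one multiplier per generator, while `InE` lists terms in any order; q is added to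
  -- the multiplier at the position of g.
  combination-add : ∀ {gens} {g : Pol n} p q r → g ∈ gens → (∀ f → ev f p ≈ ev (f ⊛ g) q + ev f r) →
    Combination gens r → Combination gens p
  combination-add {n} {gens} {g} p q r g∈ e (gs , l , s) with go gens g∈ gs l
    where
    go : ∀ gens → g ∈ gens → ∀ gs → length gs ≡ length gens → Σ (List (Pol n)) λ gs′ →
        (length gs′ ≡ length gens) ×
      (∀ f → ev f (sumP (zipWith _*P_ gs′ gens)) ≈ ev (f ⊛ g) q + ev f
          (sumP (zipWith _*P_ gs gens)))
    go (g ∷ gens) (here ≡.refl) (a ∷ gs) l = (q ++ a) ∷ gs , l , λ f → begin
      ev f ((q ++ a) *P g ++ rest)                ≈⟨ ev-++ f ((q ++ a) *P g) rest ⟩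
      ev f ((q ++ a) *P g) + ev f rest            ≈⟨ +-congʳ
          (trans (ev-*P f (q ++ a) g) (ev-++ (f ⊛ g) q a)) ⟩
      ev (f ⊛ g) q + ev (f ⊛ g) a + ev f rest     ≈⟨ +-assoc _ _ _ ⟩
      ev (f ⊛ g) q + (ev (f ⊛ g) a + ev f rest)   ≈⟨ +-congˡ (+-congʳ (ev-*P f a g)) ⟨
      ev (f ⊛ g) q + (ev f (a *P g) + ev f rest)  ≈⟨ +-congˡ (ev-++ f (a *P g) rest) ⟨
      ev (f ⊛ g) q + ev f (a *P g ++ rest)        ∎
      where rest = sumP (zipWith _*P_ gs gens)
    go (g′ ∷ gens) (there g∈) (a ∷ gs) l with go gens g∈ gs (ℕₚ.suc-injective l)
    ... | gs′ , l′ , e′ = a ∷ gs′ , ≡.cong suc l′ , λ f → trans (ev-++ f (a *P g′) _)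
      (trans (+-congˡ (e′ f)) (trans (x∙yz≈y∙xz _ _ _) (+-congˡ (sym (ev-++ f (a *P g′) _)))))
  ... | gs′ , l′ , e′ = gs′ , l′ , λ f → trans (e f) (trans (+-congˡ (s f)) (sym (e′ f)))

  h∈Jgens : ∀ n k {i} → i < n → h n k (suc i) ∈ Jgens n k
  h∈Jgens n k i<n = ∈ₚ.∈-++⁺ˡ (∈ₚ.∈-map⁺ (λ i → h n k (suc i)) (∈ₚ.∈-upTo⁺ i<n))

  e∈Jgens : ∀ n k {j} → j < k → e n (n ∸ j) ∈ Jgens n k
  e∈Jgens n k j<k = ∈ₚ.∈-++⁺ʳ (map (λ i → h n k (suc i)) (upTo n))
      (∈ₚ.∈-map⁺ (λ j → e n (n ∸ j)) (∈ₚ.∈-upTo⁺ j<k))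

  inE⇒combination : ∀ (p : Pol n) → InE k p → Combination (Jgens n k) p
  inE⇒combination {n} {k} p (none z) = combination-zero (Jgens n k) p z
  inE⇒combination {n} {k} p (term j q r j<k s R) = combination-add p q r (e∈Jgens n k j<k)
    (λ f → trans (s f) (+-congʳ (ev-cong (λ v → sym (⊛-e (n ∸ j) f v)) q))) (inE⇒combination r R)

  h-combination : ∀ n k {i} → i < n → Combination (Jgens n k) (h n k (suc i))
  h-combination n k {i} i<n = combination-add (h n k (suc i)) one [] (h∈Jgens n k i<n)
    (λ f → sym (begin
      ev (f ⊛ h n k (suc i)) one + 0#  ≈⟨ +-identityʳ _ ⟩
      1# * (f ⊛ h n k (suc i)) 0s + 0# ≈⟨ trans (+-identityʳ _) (*-identityˡ _) ⟩
      (f ⊛ h n k (suc i)) 0s           ≈⟨ ev-cong (λ v → reflexive (≡.cong f (0s-⊕ v)))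
          (h n k (suc i)) ⟩
      ev f (h n k (suc i))             ∎))
    (combination-zero (Jgens n k) [] (λ f → refl))

  leading⇒inInitial : ∀ {gens} (p : Pol n) m₀ m → Combination gens p → Leading p m₀ → m₀ ∣ₘ m →
      InInitialIdeal gens m
  leading⇒inInitial p m₀ m C le d = p , m₀ , combination⇒inIdeal p C , leading⇒initial p m₀ le , d

  standard⇒nonskip : ∀ n k → 1 ≤ k → k ≤ n → (m : Monomial n) → Standard n k m →
      ReverseNonskip n k m
  standard⇒nonskip n (suc z) _ z<n m st = small , noskip
    where
    put-∣ : ∀ {n k} (i : Fin n) (m : Monomial n) → k ≤ lookup m i → put (toℕ i) k 0s ∣ₘ m
    put-∣ Fin.zero    (x ∷ m) p Fin.zero    = p
    put-∣ Fin.zero    (x ∷ m) p (Fin.suc j) = ≡.subst (_≤ lookup m j)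
        (≡.sym (Vecₚ.lookup-replicate j 0)) z≤n
    put-∣ (Fin.suc i) (x ∷ m) p Fin.zero    = z≤n
    put-∣ (Fin.suc i) (x ∷ m) p (Fin.suc j) = put-∣ i m p j
    small : ∀ i → suc z ≤ lookup m i → ⊥
    small i p = st (leading⇒inInitial (h n (suc z) (suc (toℕ i))) (put (toℕ i) (suc z) 0s) m
        (h-combination n (suc z) (Finₚ.toℕ<n i))
      (h-leading (suc z) (Finₚ.toℕ<n i)) (put-∣ i m p))
    noskip : ∀ S → ∣ S ∣ ≡ n ∸ suc z ℕ.+ 1 → revSkip S ∣ₘ m → ⊥
    noskip S size d = st (leading⇒inInitial p (skipMon 0 bits) m (inE⇒combination p P) le
      (≡.subst (_∣ₘ m) (revSkip-skipMon S) d))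
      where
      bits = Vec.reverse S
      zeros≡ : zeros bits ≡ z
      zeros≡ = ≡.trans (zeros-reverse S) (zeros-of-size z S z<n size)
      found : Σ (Pol n) λ p → InE (suc z) p × Leading p (skipMon 0 bits)
      found = ≡.subst (λ x → Σ (Pol n) λ p → InE (suc x) p × Leading p (skipMon 0 bits)) zeros≡
        (skip-leading bits (≡.subst (_< n) (≡.sym zeros≡) z<n))
      p = proj₁ found
      P = proj₁ (proj₂ found)
      le = proj₂ (proj₂ found)

  nonskip⇒standard : ∀ n k → 1 ≤ k → k ≤ n → (m : Monomial n) → ReverseNonskip n k m →
      Standard n k m
  nonskip⇒standard n k 1≤k k≤n m (small , noskip) (p , m₀ , inI , init , m₀∣m) =
    initial-stairs n k 1≤k k≤n p m₀ inI init (nonskip⇒small {m = m₀} ns)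
        (nonskip⇒stairs n k k≤n m₀ ns)
    where
    -- Divisors of nonskip monomials are nonskip, so it suffices to treat m₀, which is itself the
    -- initial monomial of an element of the ideal.
    ns : ReverseNonskip n k m₀
    ns = (λ i k≤ → small i (ℕₚ.≤-trans k≤ (m₀∣m i))) ,
         (λ S size d → noskip S size (λ i → ℕₚ.≤-trans (d i) (m₀∣m i)))

theorem3p5 : ∀ {c ℓ} (F : Field c ℓ) (n k : ℕ) → 1 ≤ k → k ≤ n →
    (m : Monomial n) → Poly.Standard F n k m ⇔ ReverseNonskip n k m
theorem3p5 F n k 1≤k k≤n m = mk⇔
  (Polynomials.standard⇒nonskip F n k 1≤k k≤n m)
  (Polynomials.nonskip⇒standard F n k 1≤k k≤n m)
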